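{- There is a distributed algorithm in the $\mathsf{CONGEST}$ model that, on $n$-node graphs, builds a network decomposition with $O(\log n)$ colors, cluster diameter $O(\log^2 n)$, and congestion $1$ in $\mathrm{poly}(\log n)$ rounds, using only $\mathrm{poly}(\log n)$ bits of shared randomness (and no private randomness).
   Context: Model: the network is an $n$-node graph $G=(V,E)$ with a processor at each node having a unique $\Theta(\log n)$-bit identifier; computation proceeds in synchronous rounds, in each of which every node can send one message of $O(\log n)$ bits to each neighbor ($\mathsf{CONGEST}$ model). Shared randomness is a string of random bits known to all nodes. Network decomposition: a decomposition of $G$ with $c$ colors and diameter $d$ is a partition of $V$ into clusters $C_1,\dots,C_p$ together with, for each cluster $C_i$, a subtree $T_i$ of $G$ containing all nodes of $C_i$ and of diameter at most $d$, and a color $\gamma_i\in\{1,\dots,c\}$, such that clusters connected by an edge of $G$ get different colors. It has congestion $\kappa$ if each node is contained in (the trees of) at most $\kappa$ clusters of each color. -}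

module Defs where

open import Level using (0ℓ)
open import Data.Nat using (ℕ; zero; suc; _+_; _*_; _∸_; _^_; _≤_; _<_)
open import Data.Nat.Logarithm using (⌊log₂_⌋)
open import Data.Bool using (Bool; true; false; T)
open import Data.Fin using (Fin)
open import Data.Vec using (Vec)
open import Data.List using (List; []; _∷_; map; filter; allFin; length)
open import Data.List.Relation.Unary.All using (All)
open import Data.List.Relation.Unary.Unique.Propositional using (Unique)
open import Data.Maybe using (Maybe; just; nothing)
open import Data.Product using (Σ; ∃; _×_; _,_)
open import Data.Sum using (_⊎_)
open import Relation.Nullary.Decidable using (T?)
open import Relation.Binary.PropositionalEquality using (_≡_)
open import Function.Definitions using (Injective)

-- Logarithmic scale: bit length of n, L n = ⌊log₂ n⌋ + 1  (≥ 1, Θ(log n))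

L : ℕ → ℕ
L n = ⌊log₂ n ⌋ + 1

record Graph (n : ℕ) : Set where
  field
    adj     : Fin n → Fin n → Bool
    adj-sym : ∀ u v → adj u v ≡ adj v u
    irrefl  : ∀ v → adj v v ≡ false

open Graph public

Adj : ∀ {n} → Graph n → Fin n → Fin n → Set
Adj G u v = T (adj G u v)

nbrs : ∀ {n} → Graph n → Fin n → List (Fin n)
nbrs {n} G v = filter (λ u → T? (adj G v u)) (allFin n)

-- Output of a node.
--   color   : its cluster's color (colors are 0 .. c-1)
--   cluster : its cluster identifier (a cluster is a pair (color, cluster))
--   tree k  : for each color k, the (at most one, i.e. congestion 1) cluster
--             tree of color k the node belongs to: just (x , nothing) means the
--             node is the root of the tree of cluster (k , x); just (x , just p)
--             means its parent in that tree is the neighbour with identifier p.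

record Output : Set where
  field
    color   : ℕ
    cluster : ℕ
    tree    : ℕ → Maybe (ℕ × Maybe ℕ)

open Output public

-- Deterministic CONGEST algorithms reading a shared random string.
-- Local computation is unbounded (arbitrary functions), as in the model.
-- A node initially knows n, its own identifier, the identifiers of its
-- neighbours and the shared random bits.  In each round it sends to every
-- neighbour (addressed by identifier) a bit string, and then updates its
-- state from the messages received, each tagged with the sender's identifier.

record Algorithm : Set₁ where
  field
    State    : ℕ → Set
    rounds   : ℕ → ℕ
    randBits : ℕ → ℕ
    init     : (n : ℕ) → ℕ → List ℕ → Vec Bool (randBits n) → State n
    send     : (n : ℕ) → State n → ℕ → List Bool
    recv     : (n : ℕ) → State n → List (ℕ × List Bool) → State n
    output   : (n : ℕ) → State n → Output

open Algorithm public

run : (A : Algorithm) {n : ℕ} (G : Graph n) (ident : Fin n → ℕ)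
      (r : Vec Bool (randBits A n)) → ℕ → Fin n → State A n
run A {n} G ident r zero v = init A n (ident v) (map ident (nbrs G v)) r
run A {n} G ident r (suc t) v =
  recv A n (run A G ident r t v)
    (map (λ u → ident u , send A n (run A G ident r t u) (ident v)) (nbrs G v))

outputs : (A : Algorithm) {n : ℕ} (G : Graph n) (ident : Fin n → ℕ)
          (r : Vec Bool (randBits A n)) → Fin n → Output
outputs A {n} G ident r v = output A n (run A G ident r (rounds A n) v)

Bounds : ℕ → Algorithm → Set
Bounds K A =
  (∀ n → rounds A n ≤ K * L n ^ K) ×
  (∀ n → randBits A n ≤ K * L n ^ K) ×
  (∀ n s i → length (send A n s i) ≤ K * L n)

data Walk {A : Set} (R : A → A → Set) : A → A → ℕ → Set where
  nil  : ∀ {a} → Walk R a a 0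
  cons : ∀ {a b c k} → R a b → Walk R b c k → Walk R a c (suc k)

-- Network decomposition encoded by the outputs o, with c colors and
-- cluster-tree diameter d, congestion 1 (built into the output format).

module _ {n : ℕ} (G : Graph n) (ident : Fin n → ℕ) (o : Fin n → Output) where

  InTree : ℕ → ℕ → Fin n → Set
  InTree k x u = ∃ λ p → tree (o u) k ≡ just (x , p)

  IsRoot : ℕ → ℕ → Fin n → Set
  IsRoot k x u = tree (o u) k ≡ just (x , nothing)

  ParentOf : ℕ → ℕ → Fin n → Fin n → Set
  ParentOf k x u w = tree (o u) k ≡ just (x , just (ident w)) × Adj G u w × InTree k x w

  TreeEdge : ℕ → ℕ → Fin n → Fin n → Set
  TreeEdge k x u w = ParentOf k x u w ⊎ ParentOf k x w u

  record IsDecomposition (c d : ℕ) : Set where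
    field
      color-range  : ∀ v → color (o v) < c
      proper       : ∀ u v → Adj G u v → color (o u) ≡ color (o v) →
                     cluster (o u) ≡ cluster (o v)
      covers       : ∀ v → InTree (color (o v)) (cluster (o v)) v
      parent-ok    : ∀ k x v p → tree (o v) k ≡ just (x , just p) →
                     ∃ λ w → ParentOf k x v w
      root-exists  : ∀ k x v → InTree k x v → ∃ λ w → IsRoot k x w
      root-unique  : ∀ k x u w → IsRoot k x u → IsRoot k x w → u ≡ w
      -- diameter ≤ d (in particular connected; with the above, a tree)
      diameter     : ∀ k x u w → InTree k x u → InTree k x w →
                     ∃ λ ℓ → ℓ ≤ d × Walk (TreeEdge k x) u w ℓ

-- "P holds with probability ≥ 1 - 1/n^c over a uniform R-bit string":
-- there are at least (1 - 1/n^c) 2^R distinct strings on which P holds.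

HighProb : (c n R : ℕ) → (Vec Bool R → Set) → Set
HighProb c n R P =
  ∃ λ (good : List (Vec Bool R)) →
    Unique good × All P good × (n ^ c ∸ 1) * 2 ^ R ≤ n ^ c * length good

ValidIds : (a n : ℕ) → (Fin n → ℕ) → Set
ValidIds a n ident = Injective _≡_ _≡_ ident × (∀ v → ident v < 2 ^ (a * L n))

{-# OPTIONS --safe #-}
module Submission where

open import Defs
open import Data.Bool using (Bool; true; false; not; _∧_; T; if_then_else_)
open import Data.Bool.ListAction using (all)
open import Data.Bool.Properties using (T-≡; ¬-not)
import Data.Bool.Properties as Bool
open import Data.Fin using (Fin; zero; suc; toℕ; fromℕ)
import Data.Fin.Properties as Fin
open import Data.List using (List; []; _∷_; _++_; map; length; allFin)
open import Data.List.Membership.Propositional using (_∈_)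
open import Data.List.Membership.Propositional.Properties using (∈-map⁻; ∈-map⁺; ∈-filter⁻; ∈-filter⁺; ∈-allFin)
open import Data.List.Properties using (length-++; length-map; map-∘; map-cong)
open import Data.List.Relation.Unary.All using (All; []; _∷_)
import Data.List.Relation.Unary.All as All
import Data.List.Relation.Unary.All.Properties as All
open import Data.List.Relation.Unary.AllPairs using ([]; _∷_)
open import Data.List.Relation.Unary.Any using (here; there)
open import Data.List.Relation.Unary.Unique.Propositional using (Unique)
import Data.List.Relation.Unary.Unique.Propositional.Properties as Unique
open import Data.Maybe using (Maybe; just; nothing)
import Data.Maybe as Maybe
open import Data.Maybe.Properties using (just-injective)
open import Data.Nat using (ℕ; zero; suc; _+_; _*_; _∸_; _^_; _/_; _%_; _≤_; _<_; z≤n; s≤s; NonZero; >-nonZero; _≤ᵇ_; _<ᵇ_; _≡ᵇ_; _≟_; _≤?_)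
open import Data.Nat.DivMod using (_mod_; m%n<n; m<n⇒m%n≡m; m≡m%n+[m/n]*n; m<n*o⇒m/o<n)
open import Data.Nat.Logarithm using (⌊log₂_⌋; ⌊log₂⌋-mono-≤; ⌊log₂[2^n]⌋≡n)
open import Data.Nat.Properties hiding (_≟_; _≤?_)
open import Data.Nat.Solver using (module +-*-Solver)
open import Data.Product using (∃; ∃₂; _×_; _,_; proj₁; proj₂)
import Data.Product as Product
open import Data.Sum using (_⊎_; inj₁; inj₂; swap)
open import Data.Unit using (tt)
open import Data.Vec using (Vec; []; _∷_; lookup; _[_]≔_; tabulate; replicate; take; drop)
open import Data.Vec.Properties using (lookup∘update; lookup∘update′; lookup∘tabulate; ∷-injectiveʳ)
open import Function using (_∘_; Equivalence)
open import Relation.Binary.PropositionalEquality using (_≡_; _≢_; refl; sym; trans; cong; cong₂; cong-app; subst; subst₂; module ≡-Reasoning)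
open import Relation.Nullary using (¬_; Dec; yes; no; does; contradiction)
open import Relation.Nullary.Decidable using (¬?; _→-dec_; _×-dec_; T?; dec-true; dec-false)
open import Algebra.Properties.Semiring.Sum +-*-semiring using (sum; sum-cong-≗; ∑-distrib-+; *-distribˡ-sum)

-- Each colour class is one phase of a random-delay partition in the style of Miller, Peng and Xu:
-- vertex u starts a wave at a random time delay(u) = O(log n), every remaining vertex joins the
-- first wave that reaches it, and a vertex is clustered if all its remaining neighbours joined the
-- same wave.  The tree of a cluster is the whole BFS tree of its wave, unclustered vertices
-- included, so trees of one colour are disjoint.  With geometric delays, for any fixed distances
-- d(u, v), the first arrival at v precedes all others by 3 except with probability 1/16, and this
-- gap suffices for v to be clustered.
--
-- Independent delays for all identifiers need too many random bits.  But success at v depends only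
-- on the vector of distances to v, of which there are few enough for a probabilistic argument
-- (Newman's trick, here by multiplicative weights) to give poly(n) delay tables such that for every
-- distance vector at least half of the tables succeed.  A phase draws a table with O(log n) shared
-- bits, and a vertex survives O(log n) phases with probability n ^ - (c + 1).

-- Product weights

sum-mono : ∀ {b} {f g : Fin b → ℕ} → (∀ i → f i ≤ g i) → sum f ≤ sum g
sum-mono {zero}  h = z≤n
sum-mono {suc b} h = +-mono-≤ (h zero) (sum-mono (λ i → h (suc i)))

term≤sum : ∀ {b} (f : Fin b → ℕ) i → f i ≤ sum f
term≤sum f zero    = m≤m+n _ _
term≤sum f (suc i) = m≤n⇒m≤o+n (f zero) (term≤sum (λ j → f (suc j)) i)

sum-const : ∀ b x → sum {b} (λ _ → x) ≡ b * x
sum-const zero    x = refl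
sum-const (suc b) x = cong (x +_) (sum-const b x)

-- Exp w N F is the integral of F over N independent coordinates in Fin b,
-- each carrying the (unnormalised) weight w.
Exp : ∀ {b} → (Fin b → ℕ) → ∀ N → (Vec (Fin b) N → ℕ) → ℕ
Exp w zero    F = F []
Exp w (suc N) F = sum (λ k → w k * Exp w N (λ f → F (k ∷ f)))

module _ {b : ℕ} (w : Fin b → ℕ) where

  Exp-mono : ∀ N {F G : Vec (Fin b) N → ℕ} → (∀ f → F f ≤ G f) → Exp w N F ≤ Exp w N G
  Exp-mono zero    h = h []
  Exp-mono (suc N) h = sum-mono (λ k → *-monoʳ-≤ (w k) (Exp-mono N (λ f → h (k ∷ f))))

  Exp-cong : ∀ N {F G : Vec (Fin b) N → ℕ} → (∀ f → F f ≡ G f) → Exp w N F ≡ Exp w N G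
  Exp-cong zero    h = h []
  Exp-cong (suc N) h = sum-cong-≗ (λ k → cong (w k *_) (Exp-cong N (λ f → h (k ∷ f))))

  Exp-+ : ∀ N (F G : Vec (Fin b) N → ℕ) → Exp w N (λ f → F f + G f) ≡ Exp w N F + Exp w N G
  Exp-+ zero    F G = refl
  Exp-+ (suc N) F G = trans
    (sum-cong-≗ (λ k → trans (cong (w k *_) (Exp-+ N (λ f → F (k ∷ f)) (λ f → G (k ∷ f))))
                             (*-distribˡ-+ (w k) _ _)))
    (∑-distrib-+ (λ k → w k * Exp w N (λ f → F (k ∷ f))) (λ k → w k * Exp w N (λ f → G (k ∷ f))))

  Exp-* : ∀ N c (F : Vec (Fin b) N → ℕ) → Exp w N (λ f → c * F f) ≡ c * Exp w N F
  Exp-* zero    c F = refl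
  Exp-* (suc N) c F = trans
    (sum-cong-≗ (λ k → trans (cong (w k *_) (Exp-* N c (λ f → F (k ∷ f)))) (*-exchange (w k) c _)))
    (sym (*-distribˡ-sum c (λ k → w k * Exp w N (λ f → F (k ∷ f)))))
    where
    *-exchange : ∀ x y z → x * (y * z) ≡ y * (x * z)
    *-exchange x y z = trans (sym (*-assoc x y z)) (trans (cong (_* z) (*-comm x y)) (*-assoc y x z))

  Exp-sum : ∀ N {d} (c : Fin d → ℕ) (H : Fin d → Vec (Fin b) N → ℕ) →
            Exp w N (λ f → sum (λ k → c k * H k f)) ≡ sum (λ k → c k * Exp w N (H k))
  Exp-sum N {zero}  c H = Exp-* N 0 (λ _ → 0)
  Exp-sum N {suc d} c H = trans
    (Exp-+ N (λ f → c zero * H zero f) (λ f → sum (λ k → c (suc k) * H (suc k) f)))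
    (cong₂ _+_ (Exp-* N (c zero) (H zero)) (Exp-sum N (λ k → c (suc k)) (λ k → H (suc k))))

  term≤Exp : (∀ k → 1 ≤ w k) → ∀ N (F : Vec (Fin b) N → ℕ) f → F f ≤ Exp w N F
  term≤Exp w≥1 zero    F []      = ≤-refl
  term≤Exp w≥1 (suc N) F (k ∷ f) = begin
    F (k ∷ f)                                   ≤⟨ term≤Exp w≥1 N (λ f → F (k ∷ f)) f ⟩
    Exp w N (λ f → F (k ∷ f))                   ≡⟨ *-identityˡ _ ⟨
    1 * Exp w N (λ f → F (k ∷ f))               ≤⟨ *-monoˡ-≤ _ (w≥1 k) ⟩
    w k * Exp w N (λ f → F (k ∷ f))             ≤⟨ term≤sum (λ k → w k * Exp w N (λ f → F (k ∷ f))) k ⟩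
    Exp w (suc N) F                             ∎
    where open ≤-Reasoning

Exp-swap : ∀ {b d} (w : Fin b → ℕ) (w′ : Fin d → ℕ) N M (F : Vec (Fin b) N → Vec (Fin d) M → ℕ) →
           Exp w N (λ f → Exp w′ M (F f)) ≡ Exp w′ M (λ x → Exp w N (λ f → F f x))
Exp-swap w w′ zero    M F = refl
Exp-swap w w′ (suc N) M F = trans
  (sum-cong-≗ (λ k → cong (w k *_) (Exp-swap w w′ N M (λ f → F (k ∷ f)))))
  (sym (Exp-sum w′ M w (λ k x → Exp w N (λ f → F (k ∷ f) x))))

module _ {B : ℕ} (w : Fin (suc B) → ℕ) where

  -- Integrating coordinate `u` first reduces the comparison to one-dimensional slices with the
  -- other coordinates frozen.
  Exp-coordinate : ∀ N (u : Fin N) (P Q : Vec (Fin (suc B)) N → ℕ) →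
    (∀ f → sum (λ k → w k * P (f [ u ]≔ k)) ≤ sum (λ k → w k * Q (f [ u ]≔ k))) →
    Exp w N P ≤ Exp w N Q
  Exp-coordinate (suc N) zero P Q h = begin
    Exp w (suc N) P                                   ≡⟨ Exp-sum w N w (λ k f → P (k ∷ f)) ⟨
    -- The entry `zero` is a placeholder that the update at `u` overwrites.
    Exp w N (λ f → sum (λ k → w k * P (k ∷ f)))       ≤⟨ Exp-mono w N (λ f → h (zero ∷ f)) ⟩
    Exp w N (λ f → sum (λ k → w k * Q (k ∷ f)))       ≡⟨ Exp-sum w N w (λ k f → Q (k ∷ f)) ⟩
    Exp w (suc N) Q                                   ∎
    where open ≤-Reasoning
  Exp-coordinate (suc N) (suc u) P Q h = sum-mono (λ k → *-monoʳ-≤ (w k)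
    (Exp-coordinate N u (λ f → P (k ∷ f)) (λ f → Q (k ∷ f)) (λ f → h (k ∷ f))))

-- A minimum is at most the weighted mean; multiplying by `sum w` avoids division.
sum-argmin : ∀ {B} (w F : Fin (suc B) → ℕ) → ∃ λ k → F k * sum w ≤ sum (λ j → w j * F j)
sum-argmin {zero} w F = zero , ≤-reflexive
  (trans (*-distribˡ-+ (F zero) (w zero) 0) (cong₂ _+_ (*-comm (F zero) (w zero)) (*-zeroʳ (F zero))))
sum-argmin {suc B} w F with sum-argmin (λ j → w (suc j)) (λ j → F (suc j))
... | k , h with ≤-total (F zero) (F (suc k))
... | inj₁ le = zero , (begin
    F zero * (w zero + sum (λ j → w (suc j)))           ≡⟨ *-distribˡ-+ (F zero) (w zero) _ ⟩
    F zero * w zero + F zero * sum (λ j → w (suc j))    ≤⟨ +-mono-≤ (≤-reflexive (*-comm (F zero) (w zero))) (≤-trans (*-monoˡ-≤ _ le) h) ⟩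
    sum (λ j → w j * F j)                               ∎)
    where open ≤-Reasoning
... | inj₂ ge = suc k , (begin
    F (suc k) * (w zero + sum (λ j → w (suc j)))              ≡⟨ *-distribˡ-+ (F (suc k)) (w zero) _ ⟩
    F (suc k) * w zero + F (suc k) * sum (λ j → w (suc j))    ≤⟨ +-mono-≤ (≤-trans (≤-reflexive (*-comm (F (suc k)) (w zero))) (*-monoʳ-≤ (w zero) ge)) h ⟩
    sum (λ j → w j * F j)                                     ∎)
    where open ≤-Reasoning

Exp-const : ∀ {b} (w : Fin b → ℕ) N x → Exp w N (λ _ → x) ≡ sum w ^ N * x
Exp-const w zero    x = sym (*-identityˡ x)
Exp-const w (suc N) x = begin
  sum (λ k → w k * Exp w N (λ _ → x))   ≡⟨ sum-cong-≗ (λ k → trans (cong (w k *_) (Exp-const w N x)) (*-comm (w k) _)) ⟩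
  sum (λ k → (sum w ^ N * x) * w k)     ≡⟨ *-distribˡ-sum (sum w ^ N * x) w ⟨
  (sum w ^ N * x) * sum w               ≡⟨ *-comm _ (sum w) ⟩
  sum w * (sum w ^ N * x)               ≡⟨ *-assoc (sum w) (sum w ^ N) x ⟨
  sum w ^ suc N * x                     ∎
  where open ≡-Reasoning

-- Method of conditional expectations: coordinates are fixed one by one, never raising the
-- conditional mean.
Exp-argmin : ∀ {B} (w : Fin (suc B) → ℕ) N (F : Vec (Fin (suc B)) N → ℕ) →
             ∃ λ f → F f * sum w ^ N ≤ Exp w N F
Exp-argmin w zero    F = [] , ≤-reflexive (*-identityʳ _)
Exp-argmin w (suc N) F with sum-argmin w (λ k → Exp w N (λ f → F (k ∷ f)))
... | k , h with Exp-argmin w N (λ f → F (k ∷ f))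
... | f , h′ = k ∷ f , (begin
    F (k ∷ f) * (sum w * sum w ^ N)          ≡⟨ cong (F (k ∷ f) *_) (*-comm (sum w) _) ⟩
    F (k ∷ f) * (sum w ^ N * sum w)          ≡⟨ *-assoc (F (k ∷ f)) _ _ ⟨
    F (k ∷ f) * sum w ^ N * sum w            ≤⟨ *-monoˡ-≤ (sum w) h′ ⟩
    Exp w N (λ f → F (k ∷ f)) * sum w        ≤⟨ h ⟩
    Exp w (suc N) F                          ∎)
    where open ≤-Reasoning

-- Indicators and elementary sums

𝟙 : Bool → ℕ
𝟙 true  = 1
𝟙 false = 0

𝟙≤1 : ∀ x → 𝟙 x ≤ 1
𝟙≤1 true  = ≤-refl
𝟙≤1 false = z≤n

𝟙-yes : ∀ {P : Set} (P? : Dec P) → P → 𝟙 (does P?) ≡ 1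
𝟙-yes (yes _) p = refl
𝟙-yes (no ¬p) p = contradiction p ¬p

𝟙-no : ∀ {P : Set} (P? : Dec P) → ¬ P → 𝟙 (does P?) ≡ 0
𝟙-no (yes p) ¬p = contradiction p ¬p
𝟙-no (no _)  ¬p = refl

𝟙-mono : ∀ {P Q : Set} (P? : Dec P) (Q? : Dec Q) → (P → Q) → 𝟙 (does P?) ≤ 𝟙 (does Q?)
𝟙-mono (yes p) Q? f = ≤-reflexive (sym (𝟙-yes Q? (f p)))
𝟙-mono (no _)  Q? f = z≤n

sum-0 : ∀ {b} {f : Fin b → ℕ} → (∀ i → f i ≡ 0) → sum f ≡ 0
sum-0 {zero}  h = refl
sum-0 {suc b} h = cong₂ _+_ (h zero) (sum-0 (λ i → h (suc i)))

sum-unique≤1 : ∀ {b} {P : Fin b → Set} (P? : ∀ i → Dec (P i)) →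
               (∀ i j → P i → P j → i ≡ j) → sum (λ i → 𝟙 (does (P? i))) ≤ 1
sum-unique≤1 {zero}  P? uniq = z≤n
sum-unique≤1 {suc b} P? uniq with P? zero
... | yes p = ≤-reflexive (cong suc (sum-0 (λ i → 𝟙-no (P? (suc i))
                (λ q → contradiction (uniq zero (suc i) p q) λ ()))))
... | no _  = sum-unique≤1 (P? ∘ suc) (λ i j p q → Fin.suc-injective (uniq (suc i) (suc j) p q))

argmin : ∀ {n} (h : Fin (suc n) → ℕ) → ∃ λ i → ∀ j → h i ≤ h j
argmin {zero}  h = zero , λ { zero → ≤-refl }
argmin {suc n} h with argmin (h ∘ suc)
... | i , min with ≤-total (h zero) (h (suc i))
... | inj₁ le = zero , λ { zero → ≤-refl ; (suc j) → ≤-trans le (min j) }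
... | inj₂ ge = suc i , λ { zero → ge ; (suc j) → min j }

sum-initial : ∀ m (h : ℕ → ℕ) → sum {m} (h ∘ toℕ) ≤ sum {suc m} (h ∘ toℕ)
sum-initial zero    h = z≤n
sum-initial (suc m) h = +-monoʳ-≤ (h 0) (sum-initial m (h ∘ suc))

-- The gap between the first two arrivals

arrival : ∀ {d b N} → Vec (Fin d) N → Vec (Fin b) N → Fin N → ℕ
arrival D f u = toℕ (lookup D u) + toℕ (lookup f u)

-- `Leads 0` allows ties, so among finitely many waves some wave always has it; `Leads 3` holds for
-- at most one wave.
Leads : ∀ {d b N} → ℕ → Vec (Fin d) N → Vec (Fin b) N → Fin N → Set
Leads j D f u = ∀ u′ → u′ ≢ u → j + arrival D f u ≤ arrival D f u′

leads? : ∀ {d b N} j (D : Vec (Fin d) N) (f : Vec (Fin b) N) u → Dec (Leads j D f u)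
leads? j D f u = Fin.all? (λ u′ → ¬? (u′ Fin.≟ u) →-dec (_ ≤? _))

gap? : ∀ {d b N} (D : Vec (Fin d) N) (f : Vec (Fin b) N) → Dec (∃ (Leads 3 D f))
gap? D f = Fin.any? (leads? 3 D f)

gapless : ∀ {d b N} → Vec (Fin d) N → Vec (Fin b) N → Bool
gapless D f = not (does (gap? D f))

lead-unique : ∀ {d b N} (D : Vec (Fin d) N) (f : Vec (Fin b) N) u v → Leads 3 D f u → Leads 3 D f v → u ≡ v
lead-unique D f u v lu lv with u Fin.≟ v
... | yes eq = eq
... | no neq = contradiction (≤-trans (lu v (neq ∘ sym)) (≤-trans (m≤n+m _ 3) (lv u neq))) (<⇒≱ (s≤s (m≤n+m _ 2)))

-- A leader by 3 is unique and excludes gaplessness. Integrated, this bounds the gapless weight by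
-- what the leaders leave over.
leads+gapless≤1 : ∀ {d b N} (D : Vec (Fin d) N) (f : Vec (Fin b) N) →
                  sum (λ u → 𝟙 (does (leads? 3 D f u))) + 𝟙 (gapless D f) ≤ 1
leads+gapless≤1 D f with gap? D f
... | yes _  = ≤-trans (≤-reflexive (+-identityʳ _)) (sum-unique≤1 (leads? 3 D f) (lead-unique D f))
... | no ¬∃u = ≤-reflexive (cong (_+ 1) (sum-0 (λ u → 𝟙-no (leads? 3 D f u) (λ l → ¬∃u (u , l)))))

1≤leads : ∀ {d b N} .{{_ : NonZero N}} (D : Vec (Fin d) N) (f : Vec (Fin b) N) →
          1 ≤ sum (λ u → 𝟙 (does (leads? 0 D f u)))
1≤leads {N = suc _} D f with argmin (arrival D f)
... | u , min = ≤-trans (≤-reflexive (sym (𝟙-yes (leads? 0 D f u) (λ u′ _ → min u′))))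
                        (term≤sum (λ u → 𝟙 (does (leads? 0 D f u))) u)

arrival-update-≡ : ∀ {d b N} (D : Vec (Fin d) N) (f : Vec (Fin b) N) u k →
                   arrival D (f [ u ]≔ k) u ≡ toℕ (lookup D u) + toℕ k
arrival-update-≡ D f u k = cong (λ z → toℕ (lookup D u) + toℕ z) (lookup∘update u f k)

arrival-update-≢ : ∀ {d b N} (D : Vec (Fin d) N) (f : Vec (Fin b) N) {u u′} k → u′ ≢ u →
                   arrival D (f [ u ]≔ k) u′ ≡ arrival D f u′
arrival-update-≢ D f {u} {u′} k neq = cong (λ z → toℕ (lookup D u′) + toℕ z) (lookup∘update′ neq f k)

-- Lowering one delay by 3 costs a factor 32/31 in weight, except for the
-- delays 0, 1, 2, which are too rare to matter.
module Gap (B′ N : ℕ) .{{_ : NonZero N}} (ω : ℕ → ℕ)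
  (shift : ∀ k → 3 + k ≤ 2 + B′ → 31 * ω (3 + k) ≤ 32 * ω k)
  (tail : N * (31 * (ω 0 + (ω 1 + ω 2))) ≤ sum {3 + B′} (ω ∘ toℕ)) where

  w : Fin (3 + B′) → ℕ
  w = ω ∘ toℕ

  total : ℕ
  total = Exp w N (λ _ → 1)

  -- Reindexing `k` as `3 + k` costs the ratio 32/31 from `shift`; the three smallest delays have no
  -- preimage and are paid for additively.
  weight-shift : (p : ℕ → ℕ) → (∀ k → p k ≤ 1) →
    31 * sum (λ k → w k * p (toℕ k)) ≤ 31 * (ω 0 + (ω 1 + ω 2)) + 32 * sum (λ k → w k * p (3 + toℕ k))
  weight-shift p p≤1 = begin
    31 * (ω 0 * p 0 + (ω 1 * p 1 + (ω 2 * p 2 + rest)))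
      ≤⟨ *-monoʳ-≤ 31 (+-mono-≤ (discard 0) (+-mono-≤ (discard 1) (+-monoˡ-≤ rest (discard 2)))) ⟩
    31 * (ω 0 + (ω 1 + (ω 2 + rest)))
      ≡⟨ solve 4 (λ a b c r → con 31 :* (a :+ (b :+ (c :+ r))) := con 31 :* (a :+ (b :+ c)) :+ con 31 :* r) refl (ω 0) (ω 1) (ω 2) rest ⟩
    31 * (ω 0 + (ω 1 + ω 2)) + 31 * rest
      ≤⟨ +-monoʳ-≤ (31 * (ω 0 + (ω 1 + ω 2))) step ⟩
    31 * (ω 0 + (ω 1 + ω 2)) + 32 * sum (λ k → w k * p (3 + toℕ k)) ∎
    where
    open ≤-Reasoning
    open +-*-Solver
    h : ℕ → ℕ
    h k = ω k * p (3 + k)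
    rest : ℕ
    rest = sum {B′} (λ k → ω (3 + toℕ k) * p (3 + toℕ k))
    discard : ∀ k → ω k * p k ≤ ω k
    discard k = ≤-trans (*-monoʳ-≤ (ω k) (p≤1 k)) (≤-reflexive (*-identityʳ _))
    one : (k : Fin B′) → 31 * (ω (3 + toℕ k) * p (3 + toℕ k)) ≤ 32 * h (toℕ k)
    one k = ≤-trans (≤-reflexive (sym (*-assoc 31 (ω (3 + toℕ k)) (p (3 + toℕ k)))))
           (≤-trans (*-monoˡ-≤ (p (3 + toℕ k)) (shift (toℕ k) (+-monoʳ-≤ 2 (Fin.toℕ<n k))))
                    (≤-reflexive (*-assoc 32 (ω (toℕ k)) (p (3 + toℕ k)))))
    step : 31 * rest ≤ 32 * sum {3 + B′} (h ∘ toℕ)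
    step = begin
      31 * rest
        ≡⟨ *-distribˡ-sum 31 (λ (k : Fin B′) → ω (3 + toℕ k) * p (3 + toℕ k)) ⟩
      sum {B′} (λ k → 31 * (ω (3 + toℕ k) * p (3 + toℕ k)))
        ≤⟨ sum-mono one ⟩
      sum {B′} (λ k → 32 * h (toℕ k))
        ≡⟨ *-distribˡ-sum 32 (λ (k : Fin B′) → h (toℕ k)) ⟨
      32 * sum {B′} (h ∘ toℕ)
        -- The reindexed sum stops three terms short of the full range; the missing terms are
        -- nonnegative.
        ≤⟨ *-monoʳ-≤ 32 (≤-trans (sum-initial B′ h) (≤-trans (sum-initial (1 + B′) h) (sum-initial (2 + B′) h))) ⟩
      32 * sum {3 + B′} (h ∘ toℕ) ∎

  module _ {d : ℕ} (D : Vec (Fin d) N) where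

    lead : ℕ → Fin N → Vec (Fin (3 + B′)) N → ℕ
    lead j u f = 𝟙 (does (leads? j D f u))

    -- With the other delays frozen, leading by 3 at delay `k` is the same as leading by 0 at delay
    -- `3 + k`, so `weight-shift` compares the two events. The factor `N` on both sides turns the
    -- additive loss, by `tail`, into at most one `total`.
    lead-exchange : ∀ u → (N * 31) * Exp w N (lead 0 u) ≤ (N * 32) * Exp w N (lead 3 u) + total
    lead-exchange u = begin
      (N * 31) * Exp w N (lead 0 u)
        ≡⟨ Exp-* w N (N * 31) (lead 0 u) ⟨
      Exp w N (λ f → (N * 31) * lead 0 u f)
        ≤⟨ Exp-coordinate w N u (λ f → (N * 31) * lead 0 u f) (λ f → (N * 32) * lead 3 u f + 1) along ⟩
      Exp w N (λ f → (N * 32) * lead 3 u f + 1)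
        ≡⟨ Exp-+ w N (λ f → (N * 32) * lead 3 u f) (λ _ → 1) ⟩
      Exp w N (λ f → (N * 32) * lead 3 u f) + total
        ≡⟨ cong (_+ total) (Exp-* w N (N * 32) (lead 3 u)) ⟩
      (N * 32) * Exp w N (lead 3 u) + total ∎
      where
      open ≤-Reasoning
      pull : ∀ c (g : Fin (3 + B′) → ℕ) → sum (λ k → w k * (c * g k)) ≡ c * sum (λ k → w k * g k)
      pull c g = trans (sum-cong-≗ (λ k → trans (sym (*-assoc (w k) c (g k))) (trans (cong (_* g k) (*-comm (w k) c)) (*-assoc c (w k) (g k)))))
                       (sym (*-distribˡ-sum c (λ k → w k * g k)))
      along : ∀ f → sum (λ k → w k * ((N * 31) * lead 0 u (f [ u ]≔ k)))
                  ≤ sum (λ k → w k * ((N * 32) * lead 3 u (f [ u ]≔ k) + 1))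
      along f = begin
        sum (λ k → w k * ((N * 31) * lead 0 u (f [ u ]≔ k)))
          ≡⟨ pull (N * 31) (λ k → lead 0 u (f [ u ]≔ k)) ⟩
        (N * 31) * sum (λ k → w k * lead 0 u (f [ u ]≔ k))
          ≤⟨ *-monoʳ-≤ (N * 31) (sum-mono (λ k → *-monoʳ-≤ (w k) (𝟙-mono (leads? 0 D (f [ u ]≔ k) u) (clear? (toℕ k)) (from k)))) ⟩
        (N * 31) * sum (λ k → w k * p (toℕ k))
          ≡⟨ *-assoc N 31 (sum (λ k → w k * p (toℕ k))) ⟩
        N * (31 * sum (λ k → w k * p (toℕ k)))
          ≤⟨ *-monoʳ-≤ N (weight-shift p (λ k → 𝟙≤1 (does (clear? k)))) ⟩
        N * (31 * (ω 0 + (ω 1 + ω 2)) + 32 * sum (λ k → w k * p (3 + toℕ k)))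
          ≡⟨ *-distribˡ-+ N (31 * (ω 0 + (ω 1 + ω 2))) _ ⟩
        N * (31 * (ω 0 + (ω 1 + ω 2))) + N * (32 * sum (λ k → w k * p (3 + toℕ k)))
          ≤⟨ +-mono-≤ tail (≤-reflexive (sym (*-assoc N 32 (sum (λ k → w k * p (3 + toℕ k)))))) ⟩
        sum w + (N * 32) * sum (λ k → w k * p (3 + toℕ k))
          ≤⟨ +-monoʳ-≤ (sum w) (*-monoʳ-≤ (N * 32) (sum-mono (λ k → *-monoʳ-≤ (w k) (𝟙-mono (clear? (3 + toℕ k)) (leads? 3 D (f [ u ]≔ k) u) (to k))))) ⟩
        sum w + (N * 32) * sum (λ k → w k * lead 3 u (f [ u ]≔ k))
          ≡⟨ +-comm (sum w) _ ⟩
        (N * 32) * sum (λ k → w k * lead 3 u (f [ u ]≔ k)) + sum w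
          ≡⟨ cong (_+ sum w) (pull (N * 32) (λ k → lead 3 u (f [ u ]≔ k))) ⟨
        sum (λ k → w k * ((N * 32) * lead 3 u (f [ u ]≔ k))) + sum w
          ≡⟨ ∑-distrib-+ (λ k → w k * ((N * 32) * lead 3 u (f [ u ]≔ k))) w ⟨
        sum (λ k → w k * ((N * 32) * lead 3 u (f [ u ]≔ k)) + w k)
          ≡⟨ sum-cong-≗ (λ k → trans (*-distribˡ-+ (w k) _ 1) (cong (w k * ((N * 32) * lead 3 u (f [ u ]≔ k)) +_) (*-identityʳ (w k)))) ⟨
        sum (λ k → w k * ((N * 32) * lead 3 u (f [ u ]≔ k) + 1)) ∎
        where
        -- Leading by 0 is expressed for an arbitrary natural delay, because `3 + toℕ k` may exceed
        -- the largest delay.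
        Clear : ℕ → Set
        Clear k = ∀ u′ → u′ ≢ u → toℕ (lookup D u) + k ≤ arrival D f u′
        clear? : ∀ k → Dec (Clear k)
        clear? k = Fin.all? (λ u′ → ¬? (u′ Fin.≟ u) →-dec (_ ≤? _))
        p : ℕ → ℕ
        p k = 𝟙 (does (clear? k))
        from : ∀ k → Leads 0 D (f [ u ]≔ k) u → Clear (toℕ k)
        from k l u′ neq = begin
          toℕ (lookup D u) + toℕ k        ≡⟨ arrival-update-≡ D f u k ⟨
          arrival D (f [ u ]≔ k) u        ≤⟨ l u′ neq ⟩
          arrival D (f [ u ]≔ k) u′       ≡⟨ arrival-update-≢ D f k neq ⟩
          arrival D f u′                  ∎
        to : ∀ k → Clear (3 + toℕ k) → Leads 3 D (f [ u ]≔ k) u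
        to k c u′ neq = begin
          3 + arrival D (f [ u ]≔ k) u         ≡⟨ cong (3 +_) (arrival-update-≡ D f u k) ⟩
          3 + (toℕ (lookup D u) + toℕ k)       ≡⟨ solve 2 (λ a b → con 3 :+ (a :+ b) := a :+ (con 3 :+ b)) refl (toℕ (lookup D u)) (toℕ k) ⟩
          toℕ (lookup D u) + (3 + toℕ k)       ≤⟨ c u′ neq ⟩
          arrival D f u′                       ≡⟨ arrival-update-≢ D f k neq ⟨
          arrival D (f [ u ]≔ k) u′            ∎
          where open +-*-Solver

    -- Sum `lead-exchange` over `u`, with T for `total`. Some wave always leads by 0, so 31 N T is
    -- at most N T plus 32 N times the weight of leaders by 3. That weight is at most T minus the
    -- gapless weight; hence 32 N times the gapless weight is at most 2 N T.
    gapless-rare : 16 * Exp w N (λ f → 𝟙 (gapless D f)) ≤ total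
    gapless-rare = *-cancelˡ-≤ (N * 2) {{m*n≢0 N 2}} (+-cancelˡ-≤ ((N * 31) * total) _ _ (begin
      (N * 31) * total + (N * 2) * (16 * bad)
        ≡⟨ cong ((N * 31) * total +_) (solve 2 (λ n x → (n :* con 2) :* (con 16 :* x) := (n :* con 32) :* x) refl N bad) ⟩
      (N * 31) * total + (N * 32) * bad
        ≤⟨ +-monoˡ-≤ _ (*-monoʳ-≤ (N * 31) (Exp-mono w N (λ f → 1≤leads D f))) ⟩
      (N * 31) * Exp w N (λ f → sum (λ u → lead 0 u f)) + (N * 32) * bad
        ≡⟨ cong (λ z → (N * 31) * z + (N * 32) * bad) (exchange 0) ⟩
      (N * 31) * sum (λ u → Exp w N (lead 0 u)) + (N * 32) * bad
        ≡⟨ cong (_+ (N * 32) * bad) (*-distribˡ-sum (N * 31) (λ u → Exp w N (lead 0 u))) ⟩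
      sum (λ u → (N * 31) * Exp w N (lead 0 u)) + (N * 32) * bad
        ≤⟨ +-monoˡ-≤ _ (sum-mono lead-exchange) ⟩
      sum (λ u → (N * 32) * Exp w N (lead 3 u) + total) + (N * 32) * bad
        ≡⟨ cong (_+ (N * 32) * bad) (∑-distrib-+ (λ u → (N * 32) * Exp w N (lead 3 u)) (λ _ → total)) ⟩
      sum (λ u → (N * 32) * Exp w N (lead 3 u)) + sum {N} (λ _ → total) + (N * 32) * bad
        ≡⟨ cong₂ (λ x y → x + y + (N * 32) * bad) (sym (*-distribˡ-sum (N * 32) (λ u → Exp w N (lead 3 u)))) (sum-const N total) ⟩
      (N * 32) * sum (λ u → Exp w N (lead 3 u)) + N * total + (N * 32) * bad
        ≡⟨ cong (λ z → (N * 32) * z + N * total + (N * 32) * bad) (sym (exchange 3)) ⟩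
      (N * 32) * leaders + N * total + (N * 32) * bad
        ≡⟨ solve 4 (λ n x t b → n :* con 32 :* x :+ n :* t :+ n :* con 32 :* b := n :* con 32 :* (x :+ b) :+ n :* t) refl N leaders total bad ⟩
      (N * 32) * (leaders + bad) + N * total
        ≤⟨ +-monoˡ-≤ (N * total) (*-monoʳ-≤ (N * 32) (≤-trans
             (≤-reflexive (sym (Exp-+ w N (λ f → sum (λ u → lead 3 u f)) (λ f → 𝟙 (gapless D f)))))
             (Exp-mono w N (λ f → leads+gapless≤1 D f)))) ⟩
      (N * 32) * total + N * total
        ≡⟨ solve 2 (λ n t → n :* con 32 :* t :+ n :* t := n :* con 31 :* t :+ n :* con 2 :* t) refl N total ⟩
      (N * 31) * total + (N * 2) * total ∎))
      where
      open ≤-Reasoning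
      open +-*-Solver
      bad leaders : ℕ
      bad = Exp w N (λ f → 𝟙 (gapless D f))
      leaders = Exp w N (λ f → sum (λ u → lead 3 u f))
      exchange : ∀ j → Exp w N (λ f → sum (λ u → lead j u f)) ≡ sum (λ u → Exp w N (lead j u))
      exchange j = trans
        (Exp-cong w N (λ f → sum-cong-≗ (λ u → sym (*-identityˡ (lead j u f)))))
        (trans (Exp-sum w N (λ _ → 1) (lead j)) (sum-cong-≗ (λ u → *-identityˡ (Exp w N (lead j u)))))

∑ᵇ : ∀ m → (Vec Bool m → ℕ) → ℕ
∑ᵇ zero    F = F []
∑ᵇ (suc m) F = ∑ᵇ m (F ∘ (false ∷_)) + ∑ᵇ m (F ∘ (true ∷_))

-- Tables succeeding on half of the seeds

^-reflect-≤ : ∀ b {m n} → 1 < b → b ^ m ≤ b ^ n → m ≤ n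
^-reflect-≤ b {m} {n} 1<b le with m ≤? n
... | yes m≤n = m≤n
... | no m≰n  = contradiction le (<⇒≱ (^-monoʳ-< b 1<b (≰⇒> m≰n)))

^-distribʳ-* : ∀ m n o → (n * o) ^ m ≡ n ^ m * o ^ m
^-distribʳ-* zero    n o = refl
^-distribʳ-* (suc m) n o = trans (cong (n * o *_) (^-distribʳ-* m n o))
  (solve 4 (λ n o x y → n :* o :* (x :* y) := n :* x :* (o :* y)) refl n o (n ^ m) (o ^ m))
  where open +-*-Solver

-- Multiplicative weights: averaging yields one table that at most doubles the
-- total potential when every instance on which the table is bad is charged a factor 16;
-- 2 ^ m such choices leave no instance on which more than half of them are bad.
module HalfHitting {B d N M : ℕ} (w : Fin (suc B) → ℕ) (w>0 : NonZero (sum w))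
  (bad : Vec (Fin d) M → Vec (Fin (suc B)) N → Bool)
  (rare : ∀ x → 16 * Exp w N (λ f → 𝟙 (bad x f)) ≤ Exp w N (λ _ → 1)) where

  total : ℕ
  total = Exp w N (λ _ → 1)

  -- With unit weights this is the plain sum over all instances.
  Inst : (Vec (Fin d) M → ℕ) → ℕ
  Inst = Exp (λ _ → 1) M

  16^𝟙 : ∀ b → 16 ^ 𝟙 b ≡ 1 + 15 * 𝟙 b
  16^𝟙 true  = refl
  16^𝟙 false = refl

  -- Since `16 ^ 𝟙 b` is `1 + 15 * 𝟙 b`, an event of probability at most 1/16 has mean charge below
  -- 2.
  charge : ∀ x → Exp w N (λ f → 16 ^ 𝟙 (bad x f)) ≤ 2 * total
  charge x = begin
    Exp w N (λ f → 16 ^ 𝟙 (bad x f))                        ≡⟨ Exp-cong w N (λ f → 16^𝟙 (bad x f)) ⟩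
    Exp w N (λ f → 1 + 15 * 𝟙 (bad x f))                    ≡⟨ Exp-+ w N (λ _ → 1) (λ f → 15 * 𝟙 (bad x f)) ⟩
    total + Exp w N (λ f → 15 * 𝟙 (bad x f))                ≡⟨ cong (total +_) (Exp-* w N 15 (λ f → 𝟙 (bad x f))) ⟩
    total + 15 * Exp w N (λ f → 𝟙 (bad x f))                ≤⟨ +-monoʳ-≤ total (*-monoˡ-≤ (Exp w N (λ f → 𝟙 (bad x f))) (n≤1+n 15)) ⟩
    total + 16 * Exp w N (λ f → 𝟙 (bad x f))                ≤⟨ +-monoʳ-≤ total (rare x) ⟩
    total + total                                           ≡⟨ cong (total +_) (+-identityʳ total) ⟨
    2 * total                                               ∎
    where open ≤-Reasoning

  -- The potential `W` is arbitrary so that the tables for seeds starting with `true` can be chosen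
  -- against the potential left by those starting with `false`.
  charged-family : ∀ m (W : Vec (Fin d) M → ℕ) →
    ∃ λ (F : Vec Bool m → Vec (Fin (suc B)) N) →
      Inst (λ x → W x * 16 ^ ∑ᵇ m (λ i → 𝟙 (bad x (F i)))) ≤ 2 ^ (2 ^ m) * Inst W
  charged-family zero W with Exp-argmin w N (λ f → Inst (λ x → W x * 16 ^ 𝟙 (bad x f)))
  ... | f , h = (λ _ → f) , *-cancelʳ-≤ _ _ (sum w ^ N) {{m^n≢0 (sum w) N {{w>0}}}} (begin
    Inst (λ x → W x * 16 ^ 𝟙 (bad x f)) * sum w ^ N                ≤⟨ h ⟩
    Exp w N (λ f → Inst (λ x → W x * 16 ^ 𝟙 (bad x f)))            ≡⟨ Exp-swap w (λ _ → 1) N M (λ f x → W x * 16 ^ 𝟙 (bad x f)) ⟩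
    Inst (λ x → Exp w N (λ f → W x * 16 ^ 𝟙 (bad x f)))            ≡⟨ Exp-cong _ M (λ x → Exp-* w N (W x) (λ f → 16 ^ 𝟙 (bad x f))) ⟩
    Inst (λ x → W x * Exp w N (λ f → 16 ^ 𝟙 (bad x f)))            ≤⟨ Exp-mono _ M (λ x → *-monoʳ-≤ (W x) (charge x)) ⟩
    Inst (λ x → W x * (2 * total))                                 ≡⟨ Exp-cong _ M (λ x → *-comm (W x) (2 * total)) ⟩
    Inst (λ x → (2 * total) * W x)                                 ≡⟨ Exp-* _ M (2 * total) W ⟩
    (2 * total) * Inst W                                           ≡⟨ cong (λ z → (2 * z) * Inst W) (trans (Exp-const w N 1) (*-identityʳ (sum w ^ N))) ⟩
    (2 * sum w ^ N) * Inst W                                       ≡⟨ solve 2 (λ t i → (con 2 :* t) :* i := (con 2 :* i) :* t) refl (sum w ^ N) (Inst W) ⟩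
    2 * Inst W * sum w ^ N                                         ∎)
    where
    open ≤-Reasoning
    open +-*-Solver
  charged-family (suc m) W with charged-family m W
  ... | F₀ , h₀ with charged-family m (λ x → W x * 16 ^ ∑ᵇ m (λ i → 𝟙 (bad x (F₀ i))))
  ... | F₁ , h₁ = F , (begin
    Inst (λ x → W x * 16 ^ (c₀ x + c₁ x))
      ≡⟨ Exp-cong _ M (λ x → trans (cong (W x *_) (^-distribˡ-+-* 16 (c₀ x) (c₁ x))) (sym (*-assoc (W x) _ _))) ⟩
    Inst (λ x → W x * 16 ^ c₀ x * 16 ^ c₁ x)
      ≤⟨ h₁ ⟩
    2 ^ (2 ^ m) * Inst (λ x → W x * 16 ^ c₀ x)
      ≤⟨ *-monoʳ-≤ (2 ^ (2 ^ m)) h₀ ⟩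
    2 ^ (2 ^ m) * (2 ^ (2 ^ m) * Inst W)
      ≡⟨ *-assoc (2 ^ (2 ^ m)) (2 ^ (2 ^ m)) (Inst W) ⟨
    2 ^ (2 ^ m) * 2 ^ (2 ^ m) * Inst W
      ≡⟨ cong (_* Inst W) (^-distribˡ-+-* 2 (2 ^ m) (2 ^ m)) ⟨
    2 ^ (2 ^ m + 2 ^ m) * Inst W
      ≡⟨ cong (λ z → 2 ^ (2 ^ m + z) * Inst W) (+-identityʳ (2 ^ m)) ⟨
    2 ^ (2 ^ suc m) * Inst W ∎)
    where
    open ≤-Reasoning
    F : Vec Bool (suc m) → Vec (Fin (suc B)) N
    F (false ∷ i) = F₀ i
    F (true ∷ i)  = F₁ i
    c₀ c₁ : Vec (Fin d) M → ℕ
    c₀ x = ∑ᵇ m (λ i → 𝟙 (bad x (F₀ i)))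
    c₁ x = ∑ᵇ m (λ i → 𝟙 (bad x (F₁ i)))

  -- The final potential is at most `2 ^ (2 ^ m)` times the number `d ^ M` of instances, hence at
  -- most `2 ^ (2 * 2 ^ m)`. A single instance contributes `2 ^ (4 * c x)`; exponents are then
  -- compared.
  half-hitting : ∀ m → d ^ M ≤ 2 ^ (2 ^ m) →
    ∃ λ (F : Vec Bool m → Vec (Fin (suc B)) N) → ∀ x → 2 * ∑ᵇ m (λ i → 𝟙 (bad x (F i))) ≤ 2 ^ m
  half-hitting m few with charged-family m (λ _ → 1)
  ... | F , h = F , λ x → *-cancelˡ-≤ 2 (^-reflect-≤ 2 ≤-refl (begin
    2 ^ (2 * (2 * c x))                 ≡⟨ cong (2 ^_) (*-assoc 2 2 (c x)) ⟨
    2 ^ (4 * c x)                       ≡⟨ ^-*-assoc 2 4 (c x) ⟨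
    16 ^ c x                            ≡⟨ *-identityˡ _ ⟨
    1 * 16 ^ c x                        ≤⟨ term≤Exp _ (λ _ → ≤-refl) M (λ x → 1 * 16 ^ c x) x ⟩
    Inst (λ x → 1 * 16 ^ c x)           ≤⟨ h ⟩
    2 ^ (2 ^ m) * Inst (λ _ → 1)        ≡⟨ cong (2 ^ (2 ^ m) *_) (trans (Exp-const (λ _ → 1) M 1) (trans (*-identityʳ _) (cong (_^ M) (trans (sum-const d 1) (*-identityʳ d))))) ⟩
    2 ^ (2 ^ m) * d ^ M                 ≤⟨ *-monoʳ-≤ (2 ^ (2 ^ m)) few ⟩
    2 ^ (2 ^ m) * 2 ^ (2 ^ m)           ≡⟨ ^-distribˡ-+-* 2 (2 ^ m) (2 ^ m) ⟨
    2 ^ (2 ^ m + 2 ^ m)                 ≡⟨ cong (λ z → 2 ^ (2 ^ m + z)) (+-identityʳ (2 ^ m)) ⟨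
    2 ^ (2 * 2 ^ m)                     ∎))
    where
    open ≤-Reasoning
    c : Vec (Fin d) M → ℕ
    c x = ∑ᵇ m (λ i → 𝟙 (bad x (F i)))

-- Geometric delays and their parameters

n≤2^n : ∀ n → n ≤ 2 ^ n
n≤2^n zero    = z≤n
n≤2^n (suc n) = ≤-trans (+-mono-≤ (m^n>0 2 n) (n≤2^n n)) (≤-reflexive (cong (2 ^ n +_) (sym (+-identityʳ (2 ^ n)))))

-- If `s` steps of delay at least double the weight, then from delay 2 to the largest delay it grows
-- by at least `2 ^ (7 + e)`, enough against `2 ^ e` waves.
maxDelay : ℕ → ℕ → ℕ
maxDelay s e = 2 + s * (7 + e)

-- Chosen so that `2 ^ (2 ^ seedLength s e)` bounds the number `(4 + maxDelay s e) ^ (2 ^ e)` of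
-- distance vectors.
seedLength : ℕ → ℕ → ℕ
seedLength s e = 4 + maxDelay s e + e

HalfGapped : ℕ → ℕ → Set
HalfGapped s e = ∃ λ (F : Vec Bool (seedLength s e) → Vec (Fin (suc (maxDelay s e))) (2 ^ e)) →
  ∀ (D : Vec (Fin (4 + maxDelay s e)) (2 ^ e)) →
    2 * ∑ᵇ (seedLength s e) (λ i → 𝟙 (gapless D (F i))) ≤ 2 ^ seedLength s e

-- ω k is the geometric distribution with ratio q / p, scaled by p ^ (2 + B′).
module GeometricWeights (p q s e : ℕ) (1≤p : 1 ≤ p) (p≤q : p ≤ q)
  (slow : 31 * (q * (q * q)) ≤ 32 * (p * (p * p))) (double : 2 * p ^ s ≤ q ^ s) where

  B′ : ℕ
  B′ = s * (7 + e)

  ω : ℕ → ℕ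
  ω k = p ^ (2 + B′ ∸ k) * q ^ k

  shift : ∀ k → 3 + k ≤ 2 + B′ → 31 * ω (3 + k) ≤ 32 * ω k
  shift k le = begin
    31 * (p ^ j * (q * (q * (q * q ^ k))))        ≡⟨ solve 3 (λ x b y → con 31 :* (x :* (b :* (b :* (b :* y)))) := con 31 :* (b :* (b :* b)) :* (x :* y)) refl (p ^ j) q (q ^ k) ⟩
    31 * (q * (q * q)) * (p ^ j * q ^ k)          ≤⟨ *-monoˡ-≤ (p ^ j * q ^ k) slow ⟩
    32 * (p * (p * p)) * (p ^ j * q ^ k)          ≡⟨ solve 3 (λ x b y → con 32 :* (b :* (b :* b)) :* (x :* y) := con 32 :* ((b :* (b :* (b :* x))) :* y)) refl (p ^ j) p (q ^ k) ⟩
    32 * (p ^ (3 + j) * q ^ k)                    ≡⟨ cong (λ z → 32 * (p ^ z * q ^ k)) j+3 ⟩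
    32 * ω k                                      ∎
    where
    open ≤-Reasoning
    open +-*-Solver
    j : ℕ
    j = 2 + B′ ∸ (3 + k)
    j+3 : 3 + j ≡ 2 + B′ ∸ k
    j+3 = sym (trans (cong (_∸ k) (sym (m+[n∸m]≡n le)))
              (trans (cong (_∸ k) (solve 2 (λ k j → con 3 :+ k :+ j := k :+ (con 3 :+ j)) refl k j)) (m+n∸m≡n k (3 + j))))

  w : Fin (3 + B′) → ℕ
  w k = ω (toℕ k)

  last≤sum : q ^ (2 + B′) ≤ sum w
  last≤sum = begin
    q ^ (2 + B′)                            ≡⟨ *-identityˡ _ ⟨
    p ^ 0 * q ^ (2 + B′)                    ≡⟨ cong (λ z → p ^ z * q ^ (2 + B′)) (n∸n≡0 (2 + B′)) ⟨
    ω (2 + B′)                              ≡⟨ cong ω (Fin.toℕ-fromℕ (2 + B′)) ⟨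
    w (fromℕ (2 + B′))                      ≤⟨ term≤sum w (fromℕ (2 + B′)) ⟩
    sum w                                   ∎
    where open ≤-Reasoning

  doubled : 2 ^ (7 + e) * p ^ B′ ≤ q ^ B′
  doubled = begin
    2 ^ (7 + e) * p ^ (s * (7 + e))         ≡⟨ cong (2 ^ (7 + e) *_) (^-*-assoc p s (7 + e)) ⟨
    2 ^ (7 + e) * (p ^ s) ^ (7 + e)         ≡⟨ ^-distribʳ-* (7 + e) 2 (p ^ s) ⟨
    (2 * p ^ s) ^ (7 + e)                   ≤⟨ ^-monoˡ-≤ (7 + e) double ⟩
    (q ^ s) ^ (7 + e)                       ≡⟨ ^-*-assoc q s (7 + e) ⟩
    q ^ B′                                  ∎
    where
    open ≤-Reasoning

  -- The largest delay alone outweighs the left-hand side: each of the three weights is at most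
  -- `ω 2`, giving the factor 93, which is below `2 ^ 7`.
  tail : 2 ^ e * (31 * (ω 0 + (ω 1 + ω 2))) ≤ sum w
  tail = begin
    2 ^ e * (31 * (ω 0 + (ω 1 + ω 2)))      ≤⟨ *-monoʳ-≤ (2 ^ e) (*-monoʳ-≤ 31 (+-mono-≤ ω0≤ω2 (+-monoˡ-≤ (ω 2) ω1≤ω2))) ⟩
    2 ^ e * (31 * (ω 2 + (ω 2 + ω 2)))      ≡⟨ solve 3 (λ t y b → t :* (con 31 :* (y :* (b :* (b :* con 1)) :+ (y :* (b :* (b :* con 1)) :+ y :* (b :* (b :* con 1))))) := con 93 :* t :* y :* (b :* b)) refl (2 ^ e) (p ^ B′) q ⟩
    93 * 2 ^ e * p ^ B′ * (q * q)           ≤⟨ *-monoˡ-≤ (q * q) (*-monoˡ-≤ (p ^ B′) (*-monoˡ-≤ (2 ^ e) (≤ᵇ⇒≤ 93 128 tt))) ⟩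
    128 * 2 ^ e * p ^ B′ * (q * q)          ≡⟨ cong (λ z → z * p ^ B′ * (q * q)) (^-distribˡ-+-* 2 7 e) ⟨
    2 ^ (7 + e) * p ^ B′ * (q * q)          ≤⟨ *-monoˡ-≤ (q * q) doubled ⟩
    q ^ B′ * (q * q)                        ≡⟨ solve 2 (λ x b → x :* (b :* b) := b :* (b :* x)) refl (q ^ B′) q ⟩
    q ^ (2 + B′)                            ≤⟨ last≤sum ⟩
    sum w                                   ∎
    where
    open ≤-Reasoning
    open +-*-Solver
    ω1≤ω2 : ω 1 ≤ ω 2
    ω1≤ω2 = begin
      p * p ^ B′ * (q * 1)                  ≡⟨ solve 3 (λ a x b → a :* x :* (b :* con 1) := x :* (a :* (b :* con 1))) refl p (p ^ B′) q ⟩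
      p ^ B′ * (p * (q * 1))                ≤⟨ *-monoʳ-≤ (p ^ B′) (*-monoˡ-≤ (q * 1) p≤q) ⟩
      p ^ B′ * (q * (q * 1))                ∎
    ω0≤ω2 : ω 0 ≤ ω 2
    ω0≤ω2 = begin
      p * (p * p ^ B′) * 1                  ≡⟨ solve 2 (λ a x → a :* (a :* x) :* con 1 := a :* x :* (a :* con 1)) refl p (p ^ B′) ⟩
      p * p ^ B′ * (p * 1)                  ≤⟨ *-monoʳ-≤ (p * p ^ B′) (*-monoˡ-≤ 1 p≤q) ⟩
      ω 1                                   ≤⟨ ω1≤ω2 ⟩
      ω 2                                   ∎

  sum-w>0 : NonZero (sum w)
  sum-w>0 = >-nonZero (≤-trans (m^n>0 q {{>-nonZero (≤-trans 1≤p p≤q)}} (2 + B′)) last≤sum)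

  half-gapped : HalfGapped s e
  half-gapped = half-hitting (6 + B′ + e) (begin
    -- `n≤2^n` serves twice, on the base and then on the exponent.
    (6 + B′) ^ (2 ^ e)              ≤⟨ ^-monoˡ-≤ (2 ^ e) (n≤2^n (6 + B′)) ⟩
    (2 ^ (6 + B′)) ^ (2 ^ e)        ≡⟨ ^-*-assoc 2 (6 + B′) (2 ^ e) ⟩
    2 ^ ((6 + B′) * 2 ^ e)          ≤⟨ ^-monoʳ-≤ 2 (*-monoˡ-≤ (2 ^ e) (n≤2^n (6 + B′))) ⟩
    2 ^ (2 ^ (6 + B′) * 2 ^ e)      ≡⟨ cong (2 ^_) (^-distribˡ-+-* 2 (6 + B′) e) ⟨
    2 ^ (2 ^ (6 + B′ + e))          ∎)
    where
    open ≤-Reasoning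
    open Gap B′ (2 ^ e) {{m^n≢0 2 e}} ω shift tail using (gapless-rare)
    open HalfHitting {d = 6 + B′} {M = 2 ^ e} w sum-w>0 gapless gapless-rare using (half-hitting)

abstract
  -- The ratio 128/127 is so close to 1 that its cube stays below 32/31, while its 127th power
  -- reaches 2, as Bernoulli's inequality predicts. Both facts are checked by evaluation.
  slow-127 : 31 * (128 * (128 * 128)) ≤ 32 * (127 * (127 * 127))
  slow-127 = ≤ᵇ⇒≤ (31 * (128 * (128 * 128))) (32 * (127 * (127 * 127))) tt

  double-127 : 2 * 127 ^ 127 ≤ 128 ^ 127
  double-127 = ≤ᵇ⇒≤ (2 * 127 ^ 127) (128 ^ 127) tt

  delay-family : ∀ e → HalfGapped 127 e
  delay-family e = GeometricWeights.half-gapped 127 128 127 e (s≤s z≤n) (n≤1+n 127) slow-127 double-127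

-- Counting bit strings

∑ᵇ-mono : ∀ m {F G : Vec Bool m → ℕ} → (∀ r → F r ≤ G r) → ∑ᵇ m F ≤ ∑ᵇ m G
∑ᵇ-mono zero    h = h []
∑ᵇ-mono (suc m) h = +-mono-≤ (∑ᵇ-mono m (h ∘ (false ∷_))) (∑ᵇ-mono m (h ∘ (true ∷_)))

∑ᵇ-+ : ∀ m (F G : Vec Bool m → ℕ) → ∑ᵇ m (λ r → F r + G r) ≡ ∑ᵇ m F + ∑ᵇ m G
∑ᵇ-+ zero    F G = refl
∑ᵇ-+ (suc m) F G = trans
  (cong₂ _+_ (∑ᵇ-+ m (F ∘ (false ∷_)) (G ∘ (false ∷_))) (∑ᵇ-+ m (F ∘ (true ∷_)) (G ∘ (true ∷_))))
  (solve 4 (λ a b c d → (a :+ b) :+ (c :+ d) := (a :+ c) :+ (b :+ d)) refl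
    (∑ᵇ m (F ∘ (false ∷_))) (∑ᵇ m (G ∘ (false ∷_))) (∑ᵇ m (F ∘ (true ∷_))) (∑ᵇ m (G ∘ (true ∷_))))
  where open +-*-Solver

∑ᵇ-const : ∀ m x → ∑ᵇ m (λ _ → x) ≡ 2 ^ m * x
∑ᵇ-const zero    x = sym (*-identityˡ x)
∑ᵇ-const (suc m) x = trans (cong₂ _+_ (∑ᵇ-const m x) (∑ᵇ-const m x))
  (solve 2 (λ t x → t :* x :+ t :* x := con 2 :* t :* x) refl (2 ^ m) x)
  where open +-*-Solver

∑ᵇ-*ʳ : ∀ m (F : Vec Bool m → ℕ) x → ∑ᵇ m (λ r → F r * x) ≡ ∑ᵇ m F * x
∑ᵇ-*ʳ zero    F x = refl
∑ᵇ-*ʳ (suc m) F x = trans (cong₂ _+_ (∑ᵇ-*ʳ m (F ∘ (false ∷_)) x) (∑ᵇ-*ʳ m (F ∘ (true ∷_)) x))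
  (sym (*-distribʳ-+ x (∑ᵇ m (F ∘ (false ∷_))) (∑ᵇ m (F ∘ (true ∷_)))))

∑ᵇ-sum : ∀ m {n} (F : Fin n → Vec Bool m → ℕ) → ∑ᵇ m (λ r → sum (λ v → F v r)) ≡ sum (λ v → ∑ᵇ m (F v))
∑ᵇ-sum m {zero}  F = trans (∑ᵇ-const m 0) (*-zeroʳ (2 ^ m))
∑ᵇ-sum m {suc n} F = trans (∑ᵇ-+ m (F zero) (λ r → sum (λ v → F (suc v) r)))
  (cong (∑ᵇ m (F zero) +_) (∑ᵇ-sum m (F ∘ suc)))

-- Separates the seed of one phase from the independent seeds of the later phases.
∑ᵇ-split : ∀ m k (P : Vec Bool m → Vec Bool k → ℕ) →
  ∑ᵇ (m + k) (λ r → P (take m r) (drop m r)) ≡ ∑ᵇ m (λ a → ∑ᵇ k (P a))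
∑ᵇ-split zero    k P = refl
∑ᵇ-split (suc m) k P = cong₂ _+_ (∑ᵇ-split m k (P ∘ (false ∷_))) (∑ᵇ-split m k (P ∘ (true ∷_)))

-- Provides the list of good strings that `HighProb` asks for.
select : ∀ m → (Vec Bool m → Bool) → List (Vec Bool m)
select zero    P = if P [] then [] ∷ [] else []
select (suc m) P = map (false ∷_) (select m (P ∘ (false ∷_))) ++ map (true ∷_) (select m (P ∘ (true ∷_)))

select-length : ∀ m P → length (select m P) ≡ ∑ᵇ m (𝟙 ∘ P)
select-length zero P with P []
... | true  = refl
... | false = refl
select-length (suc m) P = trans
  (length-++ (map (false ∷_) (select m (P ∘ (false ∷_)))))
  (cong₂ _+_ (trans (length-map {B = Vec Bool (suc m)} (false ∷_) (select m (P ∘ (false ∷_)))) (select-length m (P ∘ (false ∷_))))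
             (trans (length-map {B = Vec Bool (suc m)} (true ∷_) (select m (P ∘ (true ∷_)))) (select-length m (P ∘ (true ∷_)))))

select-all : ∀ m P → All (λ r → P r ≡ true) (select m P)
select-all zero P with P [] in eq
... | true  = eq ∷ []
... | false = []
select-all (suc m) P = All.++⁺
  (All.map⁺ (select-all m (P ∘ (false ∷_)))) (All.map⁺ (select-all m (P ∘ (true ∷_))))

select-unique : ∀ m P → Unique (select m P)
select-unique zero P with P []
... | true  = [] ∷ []
... | false = []
select-unique (suc m) P = Unique.++⁺
  (Unique.map⁺ ∷-injectiveʳ (select-unique m (P ∘ (false ∷_))))
  (Unique.map⁺ ∷-injectiveʳ (select-unique m (P ∘ (true ∷_))))
  λ { (p , q) → disjoint (∈-map⁻ (false ∷_) p) (∈-map⁻ (true ∷_) q) }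
  where
  disjoint : ∀ {r : Vec Bool (suc m)} {P Q : Vec Bool m → Set} →
             (∃ λ a → P a × r ≡ false ∷ a) → ¬ (∃ λ b → Q b × r ≡ true ∷ b)
  disjoint (_ , _ , refl) (_ , _ , ())

-- The partition computed in one phase

-- The bound `b` is the default when no smaller number qualifies; hence the strict inequality in
-- `least-holds`.
least : {P : ℕ → Set} → (∀ ℓ → Dec (P ℓ)) → ∀ b → Fin (suc b)
least P? zero = zero
least P? (suc b) with P? 0
... | yes _ = zero
... | no _  = suc (least (P? ∘ suc) b)

least-≤ : {P : ℕ → Set} (P? : ∀ ℓ → Dec (P ℓ)) → ∀ b {ℓ} → P ℓ → toℕ (least P? b) ≤ ℓ
least-≤ P? zero p = z≤n
least-≤ P? (suc b) {ℓ} p with P? 0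
... | yes _ = z≤n
least-≤ P? (suc b) {zero}  p | no ¬p = contradiction p ¬p
least-≤ P? (suc b) {suc ℓ} p | no ¬p = s≤s (least-≤ (P? ∘ suc) b p)

least-holds : {P : ℕ → Set} (P? : ∀ ℓ → Dec (P ℓ)) → ∀ b → toℕ (least P? b) < b → P (toℕ (least P? b))
least-holds P? (suc b) lt with P? 0
... | yes p = p
least-holds P? (suc b) (s≤s lt) | no _ = least-holds (P? ∘ suc) b lt

-- A cell label together with the identifier of the parent (nothing for the root).
Cell : ℕ → Set
Cell N = Maybe (Fin N × Maybe ℕ)

Inbox : ℕ → Set
Inbox N = List (ℕ × Maybe (Fin N))

label : ∀ {N} → Cell N → Maybe (Fin N)
label = Maybe.map proj₁

-- Simultaneous waves are resolved by message order. The tree structure rests on label and parent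
-- coming from the same message.
heard : ∀ {N} → Inbox N → Maybe (Fin N × ℕ)
heard []                    = nothing
heard ((p , just x) ∷ ms)   = just (x , p)
heard ((p , nothing) ∷ ms)  = heard ms

adopt : ∀ {N} → Bool → Fin N → Maybe (Fin N × ℕ) → Cell N
adopt ready me (just (x , p)) = just (x , just p)
adopt true  me nothing        = just (me , nothing)
adopt false me nothing        = nothing

join : ∀ {N} → Bool → Bool → Fin N → Cell N → Inbox N → Cell N
join alive ready me (just c) ms = just c
join false ready me nothing  ms = nothing
join true  ready me nothing  ms = adopt ready me (heard ms)

-- An unlabelled neighbour is never clustered in the same phase, so it cannot violate properness.
agrees : ∀ {N} → Fin N → ℕ × Maybe (Fin N) → Bool
agrees x (_ , nothing) = true
agrees x (_ , just y)  = does (y Fin.≟ x)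

settled : ∀ {N} → Cell N → Inbox N → Bool
settled nothing        ms = false
settled (just (x , _)) ms = all (agrees x) ms

heard-∈ : ∀ {N} (ms : Inbox N) {x p} → heard ms ≡ just (x , p) → (p , just x) ∈ ms
heard-∈ ((p , just x) ∷ ms)  refl = here refl
heard-∈ ((p , nothing) ∷ ms) eq   = there (heard-∈ ms eq)

∈-heard : ∀ {N} (ms : Inbox N) {x p} → (p , just x) ∈ ms → ∃ λ c → heard ms ≡ just c
∈-heard ((p , just x) ∷ ms)  h            = _ , refl
∈-heard ((p , nothing) ∷ ms) (there h)    = ∈-heard ms h

join-inv : ∀ {N} a r me (c : Cell N) ms {x q} → join a r me c ms ≡ just (x , q) →
  c ≡ just (x , q) ⊎
  (a ≡ true × ((∃ λ p → q ≡ just p × (p , just x) ∈ ms) ⊎ (r ≡ true × x ≡ me × q ≡ nothing)))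
join-inv a     r     me (just c) ms eq = inj₁ eq
join-inv true  r     me nothing  ms eq with heard ms in h
join-inv true  r     me nothing  ms refl | just (x , p) = inj₂ (refl , inj₁ (p , refl , heard-∈ ms h))
join-inv true  true  me nothing  ms refl | nothing      = inj₂ (refl , inj₂ (refl , refl , refl))

join-heard : ∀ {N} r me (c : Cell N) ms {x p} → (p , just x) ∈ ms → ∃ λ c′ → join true r me c ms ≡ just c′
join-heard r me (just c) ms h = c , refl
join-heard r me nothing  ms h with ∈-heard ms h
... | (x , p) , eq rewrite eq = _ , refl

join-ready : ∀ {N} me (c : Cell N) ms → ∃ λ c′ → join true true me c ms ≡ just c′
join-ready me (just c) ms = c , refl
join-ready me nothing  ms with heard ms
... | just (x , p) = _ , refl
... | nothing      = _ , refl

all-intro : ∀ {N} (x : Fin N) (ms : Inbox N) → (∀ {p y} → (p , just y) ∈ ms → y ≡ x) → all (agrees x) ms ≡ true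
all-intro x []                    h = refl
all-intro x ((p , nothing) ∷ ms)  h = all-intro x ms (h ∘ there)
all-intro x ((p , just y) ∷ ms)   h rewrite dec-true (y Fin.≟ x) (h (here refl)) = all-intro x ms (h ∘ there)

all-elim : ∀ {N} (x : Fin N) (ms : Inbox N) → all (agrees x) ms ≡ true → ∀ {p y} → (p , just y) ∈ ms → y ≡ x
all-elim x ((p , nothing) ∷ ms) eq (there h) = all-elim x ms eq h
all-elim x ((p , just y) ∷ ms)  eq h with y Fin.≟ x
all-elim x ((p , just y) ∷ ms)  eq (here refl) | yes y≡x = y≡x
all-elim x ((p , just y) ∷ ms)  eq (there h)   | yes _   = all-elim x ms eq h
all-elim x ((p , just y) ∷ ms)  () h           | no _

settled-intro : ∀ {N} {c : Cell N} {ms x q} → c ≡ just (x , q) →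
  (∀ {p y} → (p , just y) ∈ ms → y ≡ x) → settled c ms ≡ true
settled-intro {ms = ms} {x} refl h = all-intro x ms h

settled-elim : ∀ {N} (c : Cell N) ms → settled c ms ≡ true →
  ∃₂ λ x q → c ≡ just (x , q) × (∀ {p y} → (p , just y) ∈ ms → y ≡ x)
settled-elim (just (x , q)) ms eq = x , q , refl , all-elim x ms eq

label-inv : ∀ {N} (c : Cell N) {x} → label c ≡ just x → ∃ λ q → c ≡ just (x , q)
label-inv (just (x , q)) refl = q , refl

-- Waves and their timing

module Flood {n N : ℕ} (G : Graph n) (ident : Fin n → ℕ) (ι : Fin n → Fin N) where

  inbox : (Fin n → Cell N) → Fin n → Inbox N
  inbox c v = map (λ u → ident u , label (c u)) (nbrs G v)

  inbox-inv : ∀ c v {p x} → (p , just x) ∈ inbox c v →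
    ∃ λ w → p ≡ ident w × Adj G v w × ∃ λ q → c w ≡ just (x , q)
  inbox-inv c v h with ∈-map⁻ (λ u → ident u , label (c u)) h
  ... | w , w∈ , eq = w , cong proj₁ eq , proj₂ (∈-filter⁻ (λ u → T? (adj G v u)) {xs = allFin n} w∈) ,
                      label-inv (c w) (sym (cong proj₂ eq))

  inbox-intro : ∀ c {v w x q} → Adj G v w → c w ≡ just (x , q) → (ident w , just x) ∈ inbox c v
  inbox-intro c {v} {w} vw eq = subst (λ z → (ident w , z) ∈ inbox c v) (cong label eq)
    (∈-map⁺ (λ u → ident u , label (c u)) (∈-filter⁺ (λ u → T? (adj G v u)) (∈-allFin w) vw))

  module Region (A : Fin n → Bool) where

    -- A walk of exactly `ℓ` steps inside `A`; the least such `ℓ` is the distance in the remaining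
    -- graph.
    Ball : ℕ → Fin n → Fin N → Set
    Ball zero    v x = A v ≡ true × ι v ≡ x
    Ball (suc ℓ) v x = A v ≡ true × ∃ λ w → Adj G v w × Ball ℓ w x

    ball? : ∀ ℓ v x → Dec (Ball ℓ v x)
    ball? zero    v x = (A v Bool.≟ true) ×-dec (ι v Fin.≟ x)
    ball? (suc ℓ) v x = (A v Bool.≟ true) ×-dec Fin.any? (λ w → T? (adj G v w) ×-dec ball? ℓ w x)

    -- Distance 3 + B stands for infinity.
    dist : ∀ B → Fin n → Vec (Fin (4 + B)) N
    dist B v = tabulate (λ x → least (λ ℓ → ball? ℓ v x) (3 + B))

    dist-≡ : ∀ B v x → toℕ (lookup (dist B v) x) ≡ toℕ (least (λ ℓ → ball? ℓ v x) (3 + B))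
    dist-≡ B v x = cong toℕ (lookup∘tabulate (λ x → least (λ ℓ → ball? ℓ v x) (3 + B)) x)

    dist-≤ : ∀ B v x {ℓ} → Ball ℓ v x → toℕ (lookup (dist B v) x) ≤ ℓ
    dist-≤ B v x ball = ≤-trans (≤-reflexive (dist-≡ B v x)) (least-≤ (λ ℓ → ball? ℓ v x) (3 + B) ball)

    dist-ball : ∀ B v x → toℕ (lookup (dist B v) x) < 3 + B → Ball (toℕ (lookup (dist B v) x)) v x
    dist-ball B v x lt = subst (λ ℓ → Ball ℓ v x) (sym (dist-≡ B v x))
      (least-holds (λ ℓ → ball? ℓ v x) (3 + B) (subst (_< 3 + B) (dist-≡ B v x) lt))

  module Phase {B : ℕ} (A : Fin n → Bool) (f : Vec (Fin (suc B)) N) where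

    open Region A

    delay : Fin N → ℕ
    delay x = toℕ (lookup f x)

    cells : ℕ → Fin n → Cell N
    cells zero    v = nothing
    cells (suc t) v = join (A v) (delay (ι v) ≤ᵇ t) (ι v) (cells t v) (inbox (cells t) v)

    cells-inv : ∀ t v {x q} → cells (suc t) v ≡ just (x , q) →
      cells t v ≡ just (x , q) ⊎
      (A v ≡ true × ((∃ λ p → q ≡ just p × (p , just x) ∈ inbox (cells t) v) ⊎
                     ((delay (ι v) ≤ᵇ t) ≡ true × x ≡ ι v × q ≡ nothing)))
    cells-inv t v = join-inv (A v) (delay (ι v) ≤ᵇ t) (ι v) (cells t v) (inbox (cells t) v)

    cells-suc : ∀ t v {c} → cells t v ≡ just c → cells (suc t) v ≡ just c
    cells-suc t v eq rewrite eq = refl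

    cells-mono : ∀ {t t′} → t ≤ t′ → ∀ {v c} → cells t v ≡ just c → cells t′ v ≡ just c
    cells-mono {t} {t′} t≤t′ {v} {c} eq = subst (λ s → cells s v ≡ just c) (m∸n+n≡m t≤t′) (go (t′ ∸ t))
      where
      go : ∀ k → cells (k + t) v ≡ just c
      go zero    = eq
      go (suc k) = cells-suc (k + t) v (go k)

    cells-alive : ∀ t v {c} → cells t v ≡ just c → A v ≡ true
    cells-alive (suc t) v eq with cells-inv t v eq
    ... | inj₁ eq′      = cells-alive t v eq′
    ... | inj₂ (Av , _) = Av

    cells-root : ∀ t v {x} → cells t v ≡ just (x , nothing) → x ≡ ι v
    cells-root (suc t) v eq with cells-inv t v eq
    ... | inj₁ eq′                        = cells-root t v eq′
    ... | inj₂ (_ , inj₁ (_ , () , _))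
    ... | inj₂ (_ , inj₂ (_ , x≡ , _))    = x≡

    Parent : ℕ → Fin N → Fin n → Fin n → Set
    Parent t x v w = cells t v ≡ just (x , just (ident w)) × Adj G v w × ∃ λ q → cells t w ≡ just (x , q)

    -- A label is copied from a neighbour that already carries it and never changes, so the parent
    -- pointer stays valid.
    cells-parent : ∀ t v {x p} → cells t v ≡ just (x , just p) → ∃ λ w → p ≡ ident w × Parent t x v w
    cells-parent (suc t) v eq with cells-inv t v eq
    ... | inj₁ eq′ = let (w , p≡ , _ , vw , q , eqw) = cells-parent t v eq′ in
                     w , p≡ , trans eq (cong (λ z → just (_ , just z)) p≡) , vw , q , cells-suc t w eqw
    ... | inj₂ (_ , inj₁ (_ , refl , p∈)) = let (w , p≡ , vw , q , eqw) = inbox-inv (cells t) v p∈ in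
                     w , p≡ , trans eq (cong (λ z → just (_ , just z)) p≡) , vw , q , cells-suc t w eqw
    ... | inj₂ (_ , inj₂ (_ , _ , ()))

    -- Each parent was labelled in an earlier round than its child, so the root is reached within
    -- `t` steps. Edges are taken at the later time `t′` so that paths from different vertices lie
    -- in one tree.
    cells-path : ∀ {t t′} → t ≤ t′ → ∀ v {x q} → cells t v ≡ just (x , q) →
      ∃₂ λ w ℓ → ℓ ≤ t × Walk (Parent t′ x) v w ℓ × cells t′ w ≡ just (x , nothing)
    cells-path {suc t} t<t′ v eq with cells-inv t v eq
    ... | inj₁ eq′ = let (w , ℓ , ℓ≤ , walk , root) = cells-path (<⇒≤ t<t′) v eq′ in
                     w , ℓ , m≤n⇒m≤1+n ℓ≤ , walk , root
    ... | inj₂ (_ , inj₂ (_ , _ , refl)) = v , 0 , z≤n , nil , cells-mono t<t′ eq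
    ... | inj₂ (_ , inj₁ (p , refl , p∈)) with inbox-inv (cells t) v p∈
    ... | u , refl , vu , q , equ = let (w , ℓ , ℓ≤ , walk , root) = cells-path (<⇒≤ t<t′) u equ in
                     w , suc ℓ , s≤s ℓ≤ , cons (cells-mono t<t′ eq , vu , q , cells-mono (<⇒≤ t<t′) equ) walk , root

    -- A wave waits for its delay and then advances at most one edge per round, so no label appears
    -- too early.
    cells-ball : ∀ t v {x q} → cells t v ≡ just (x , q) → ∃ λ ℓ → Ball ℓ v x × delay x + ℓ < t
    cells-ball (suc t) v eq with cells-inv t v eq
    ... | inj₁ eq′ = let (ℓ , ball , lt) = cells-ball t v eq′ in ℓ , ball , m≤n⇒m≤1+n lt
    ... | inj₂ (Av , inj₂ (ready , refl , _)) = 0 , (Av , refl) ,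
            s≤s (≤-trans (≤-reflexive (+-identityʳ _)) (≤ᵇ⇒≤ (delay (ι v)) t (Equivalence.from T-≡ ready)))
    ... | inj₂ (Av , inj₁ (p , refl , p∈)) with inbox-inv (cells t) v p∈
    ... | u , _ , vu , _ , equ = let (ℓ , ball , lt) = cells-ball t u equ in
            suc ℓ , (Av , u , vu , ball) , s≤s (≤-trans (≤-reflexive (+-suc _ ℓ)) lt)

    -- A converse without control of the label: another wave may reach an intermediate vertex first
    -- and continue in place of that of `x`.
    ball-cells : ∀ t ℓ v {x} → Ball ℓ v x → delay x + ℓ < t → ∃ λ c → cells t v ≡ just c
    ball-cells (suc t) zero v (Av , refl) (s≤s le)
      rewrite Av | Equivalence.to T-≡ (≤⇒≤ᵇ (≤-trans (m≤m+n (delay (ι v)) 0) le))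
      = join-ready (ι v) (cells t v) (inbox (cells t) v)
    ball-cells (suc t) (suc ℓ) v {x} (Av , w , vw , ball) (s≤s le)
      with ball-cells t ℓ w ball (≤-trans (≤-reflexive (sym (+-suc (delay x) ℓ))) le)
    ... | (y , q) , eqw rewrite Av = join-heard (delay (ι v) ≤ᵇ t) (ι v) (cells t v) (inbox (cells t) v) (inbox-intro (cells t) vw eqw)

    final : Fin n → Cell N
    final = cells (2 + B)

    keep : Fin n → Bool
    keep v = settled (final v) (inbox final v)

    next : Fin n → Bool
    next v = A v ∧ not (keep v)

    -- Within three time units of the first arrival, s, at v only one wave reaches v,
    -- so v and all its neighbours, which are reached by time s + 1, lie in its cell.
    -- (A wave arriving at time s shows in cells from round s + 1 on.)
    gap⇒keep : ∀ v → A v ≡ true → ∀ u → Leads 3 (dist B v) f u → keep v ≡ true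
    gap⇒keep v Av u lead = settled-intro (proj₂ (in-cell v ball-v (n≤1+n _) (λ {ℓ} b → ℓ , n≤1+n ℓ , b)))
                             neighbours
      where
      D : Fin N → ℕ
      D x = toℕ (lookup (dist B v) x)
      s : ℕ
      s = arrival (dist B v) f u
      -- The own delay of `v` bounds the first arrival by `B`, so the distance to `u` is genuine and
      -- not the value standing for infinity.
      self : arrival (dist B v) f (ι v) ≤ B
      self = ≤-trans (+-mono-≤ (dist-≤ B v (ι v) {0} (Av , refl)) ≤-refl) (Fin.toℕ≤pred[n] (lookup f (ι v)))
      s≤B : s ≤ B
      s≤B with ι v Fin.≟ u
      ... | yes refl = self
      ... | no neq   = ≤-trans (≤-trans (m≤n+m s 3) (lead (ι v) neq)) self
      ball-v : Ball (D u) v u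
      ball-v = dist-ball B v u (≤-trans (s≤s (≤-trans (m≤m+n (D u) _) s≤B)) (m≤n+m (suc B) 2))
      only-u : ∀ {ℓ x} → Ball ℓ v x → delay x + ℓ < 3 + s → x ≡ u
      only-u {ℓ} {x} ball lt with x Fin.≟ u
      ... | yes eq = eq
      ... | no neq = contradiction (lead x neq) (<⇒≱ (≤-trans (s≤s
              (≤-trans (+-monoˡ-≤ (delay x) (dist-≤ B v x ball)) (≤-reflexive (+-comm ℓ (delay x))))) lt))
      -- Applied to `v` and to its neighbours. By round `2 + s` some wave has labelled `w`; `near`
      -- carries its walk over to `v` with at most one more step, so `only-u` identifies it.
      in-cell : ∀ w {ℓ} → Ball ℓ w u → ℓ ≤ suc (D u) →
        (∀ {ℓ x} → Ball ℓ w x → ∃ λ ℓ′ → ℓ′ ≤ suc ℓ × Ball ℓ′ v x) →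
        ∃ λ q → final w ≡ just (u , q)
      in-cell w {ℓ} ball ℓ≤ near with ball-cells (2 + s) ℓ w ball
          (s≤s (≤-trans (+-monoʳ-≤ (delay u) ℓ≤) (≤-reflexive (trans (+-suc (delay u) (D u)) (cong suc (+-comm (delay u) (D u)))))))
      ... | (x , q) , eq with cells-ball (2 + s) w eq
      ... | ℓ₁ , ball₁ , lt₁ with near ball₁
      ... | ℓ′ , ℓ′≤ , ball′ = q , trans (cells-mono (+-monoʳ-≤ 2 s≤B) eq) (cong (λ z → just (z , q))
              (only-u ball′ (s≤s (≤-trans (+-monoʳ-≤ (delay x) ℓ′≤) (≤-trans (≤-reflexive (+-suc (delay x) ℓ₁)) lt₁)))))
      neighbours : ∀ {p y} → (p , just y) ∈ inbox final v → y ≡ u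
      neighbours {p} {y} h with inbox-inv final v h
      ... | w , _ , vw , q , eqw with in-cell w (cells-alive (2 + B) w eqw , v , subst T (adj-sym G v w) vw , ball-v)
                                       ≤-refl (λ {ℓ} b → suc ℓ , ≤-refl , Av , w , vw , b)
      ... | q′ , eqw′ = cong proj₁ (just-injective (trans (sym eqw) eqw′))

    -- The contrapositive of `gap⇒keep`, with indicators so that it can be summed over seeds.
    next⇒gapless : ∀ v → 𝟙 (next v) ≤ 𝟙 (gapless (dist B v) f)
    next⇒gapless v = dropped (A v) (keep v) (gap? (dist B v) f) (λ Av (u , lead) → gap⇒keep v Av u lead)
      where
      dropped : ∀ a k {X : Set} (X? : Dec X) → (a ≡ true → X → k ≡ true) → 𝟙 (a ∧ not k) ≤ 𝟙 (not (does X?))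
      dropped a     k (no _)  h = 𝟙≤1 (a ∧ not k)
      dropped false k (yes _) h = z≤n
      dropped true  k (yes x) h = ≤-reflexive (cong (𝟙 ∘ not) (h refl x))

-- The distributed algorithm

module _ {A : Set} {R : A → A → Set} where

  walk-++ : ∀ {a b c k ℓ} → Walk R a b k → Walk R b c ℓ → Walk R a c (k + ℓ)
  walk-++ nil        q = q
  walk-++ (cons r p) q = cons r (walk-++ p q)

  walk-reverse : (∀ {a b} → R a b → R b a) → ∀ {a b k} → Walk R a b k → Walk R b a k
  walk-reverse symm nil = nil
  walk-reverse symm (cons {k = k} r p) = subst (Walk R _ _) (+-comm k 1)
    (walk-++ (walk-reverse symm p) (cons (symm r) nil))

walk-map : ∀ {A : Set} {R S : A → A → Set} → (∀ {a b} → R a b → S a b) → ∀ {a b k} → Walk R a b k → Walk S a b k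
walk-map f nil        = nil
walk-map f (cons r p) = cons (f r) (walk-map f p)

-- Messages and node states

toBits : ℕ → ℕ → List Bool
toBits zero    x = []
toBits (suc k) x = (x % 2 ≡ᵇ 1) ∷ toBits k (x / 2)

fromBits : List Bool → ℕ
fromBits []       = 0
fromBits (b ∷ bs) = 𝟙 b + fromBits bs * 2

fromBits-toBits : ∀ k x → x < 2 ^ k → fromBits (toBits k x) ≡ x
fromBits-toBits zero    zero    lt = refl
fromBits-toBits zero    (suc x) (s≤s ())
fromBits-toBits (suc k) x       lt = trans
  (cong₂ (λ p q → p + q * 2) (parity (x % 2) (m%n<n x 2))
    (fromBits-toBits k (x / 2) (m<n*o⇒m/o<n (subst (x <_) (*-comm 2 (2 ^ k)) lt))))
  (sym (m≡m%n+[m/n]*n x 2))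
  where
  parity : ∀ r → r < 2 → 𝟙 (r ≡ᵇ 1) ≡ r
  parity 0 _ = refl
  parity 1 _ = refl
  parity (suc (suc r)) (s≤s (s≤s ()))

length-toBits : ∀ k x → length (toBits k x) ≡ k
length-toBits zero    x = refl
length-toBits (suc k) x = cong suc (length-toBits k (x / 2))

toFin : ∀ e → ℕ → Fin (2 ^ e)
toFin e x = _mod_ x (2 ^ e) {{m^n≢0 2 e}}

toℕ-toFin : ∀ e {x} → x < 2 ^ e → toℕ (toFin e x) ≡ x
toℕ-toFin e {x} lt = trans (Fin.toℕ-fromℕ< (m%n<n x (2 ^ e) {{m^n≢0 2 e}})) (m<n⇒m%n≡m {{m^n≢0 2 e}} lt)

-- The leading bit distinguishes a label from silence even when `e` is 0.
encode : ∀ e → Maybe (Fin (2 ^ e)) → List Bool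
encode e nothing  = []
encode e (just x) = true ∷ toBits e (toℕ x)

decode : ∀ e → List Bool → Maybe (Fin (2 ^ e))
decode e []       = nothing
decode e (_ ∷ bs) = just (toFin e (fromBits bs))

decode-encode : ∀ e x → decode e (encode e x) ≡ x
decode-encode e nothing  = refl
decode-encode e (just x) = cong just (Fin.toℕ-injective (begin
  toℕ (toFin e (fromBits (toBits e (toℕ x))))   ≡⟨ cong (toℕ ∘ toFin e) (fromBits-toBits e (toℕ x) (Fin.toℕ<n x)) ⟩
  toℕ (toFin e (toℕ x))                         ≡⟨ toℕ-toFin e (Fin.toℕ<n x) ⟩
  toℕ x                                         ∎))
  where open ≡-Reasoning

length-encode : ∀ e x → length (encode e x) ≤ suc e
length-encode e nothing  = z≤n
length-encode e (just x) = ≤-reflexive (cong suc (length-toBits e (toℕ x)))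

record Node (N B : ℕ) : Set where
  constructor node
  field
    me      : Fin N
    phase   : ℕ
    time    : ℕ
    delays  : ℕ → Vec (Fin (suc B)) N
    alive   : Bool
    cell    : Cell N
    forest  : ℕ → Cell N
    col     : ℕ
    clu     : ℕ

open Node

extend : ∀ {N} → (ℕ → Cell N) → ℕ → Cell N → ℕ → Cell N
extend g k c j = if does (j ≟ k) then c else g j

extend-≡ : ∀ {N} (g : ℕ → Cell N) k c → extend g k c k ≡ c
extend-≡ g k c = cong (λ b → if b then c else g k) (dec-true (k ≟ k) refl)

extend-≢ : ∀ {N} (g : ℕ → Cell N) {j k} c → j ≢ k → extend g k c j ≡ g j
extend-≢ g {j} {k} c j≢k = cong (λ b → if b then c else g j) (dec-false (j ≟ k) j≢k)

labelℕ : ∀ {N} → Cell N → ℕ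
labelℕ (just (x , _)) = toℕ x
labelℕ nothing        = 0

spread : ∀ {N B} → Node N B → Inbox N → Node N B
spread (node me k t d a c g col clu) ms =
  node me k (suc t) d a (join a (toℕ (lookup (d k) me) ≤ᵇ t) me c ms) g col clu

finish : ∀ {N B} → Node N B → Inbox N → Node N B
finish (node me k t d a c g col clu) ms =
  node me (suc k) 0 d (a ∧ not (settled c ms)) nothing (extend g k c)
    (if settled c ms then k else col) (if settled c ms then labelℕ c else clu)

-- A phase has `2 + B` rounds of spreading and one closing round, whose messages carry the final
-- labels.
update : ∀ {N B} → Node N B → Inbox N → Node N B
update {N} {B} s ms = if time s <ᵇ 2 + B then spread s ms else finish s ms

-- Each phase consumes `m` fresh bits; the all-zero table only fills phase indices beyond the last.
tables : ∀ {m N B} → (Vec Bool m → Vec (Fin (suc B)) N) → ∀ j → Vec Bool (j * m) → ℕ → Vec (Fin (suc B)) N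
tables     F zero    r k       = replicate _ zero
tables {m} F (suc j) r zero    = F (take m r)
tables {m} F (suc j) r (suc k) = tables F j (drop m r) k

module Protocol (e B m phases : ℕ → ℕ) (F : ∀ n → Vec Bool (m n) → Vec (Fin (suc (B n))) (2 ^ e n)) where

  algorithm : Algorithm
  algorithm .State n      = Node (2 ^ e n) (B n)
  algorithm .rounds n     = phases n * (3 + B n)
  algorithm .randBits n   = phases n * m n
  algorithm .init n i _ r = node (toFin (e n) i) 0 0 (tables (F n) (phases n) r) true nothing (λ _ → nothing) 0 0
  algorithm .send n s _   = encode (e n) (label (cell s))
  algorithm .recv n s ms  = update s (map (Product.map₂ (decode (e n))) ms)
  algorithm .output n s   = record
    { color = col s ; cluster = clu s ; tree = λ k → Maybe.map (Product.map₁ toℕ) (forest s k) }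

-- Global description of all phases

module Phases {n N B : ℕ} (G : Graph n) (ident : Fin n → ℕ) (ι : Fin n → Fin N) where

  open Flood G ident ι

  -- The recursion removes the first phase, as in `tables` and in the induction for survival;
  -- `alives-suc` gives the view from the last phase, which the run follows.
  alives : (Fin n → Bool) → (ℕ → Vec (Fin (suc B)) N) → ℕ → Fin n → Bool
  alives S d zero    = S
  alives S d (suc k) = alives (Phase.next S (d 0)) (d ∘ suc) k

  alives-suc : ∀ S d k → alives S d (suc k) ≡ Phase.next (alives S d k) (d k)
  alives-suc S d zero    = refl
  alives-suc S d (suc k) = alives-suc (Phase.next S (d 0)) (d ∘ suc) k

  alives-dead : ∀ S d k v → S v ≡ false → alives S d k v ≡ false
  alives-dead S d zero    v Sv = Sv
  alives-dead S d (suc k) v Sv = alives-dead (Phase.next S (d 0)) (d ∘ suc) k v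
    (cong (_∧ not (Phase.keep S (d 0) v)) Sv)

  module Spec (d : ℕ → Vec (Fin (suc B)) N) where

    A : ℕ → Fin n → Bool
    A = alives (λ _ → true) d

    module P k = Phase (A k) (d k)

    forestS : ℕ → Fin n → ℕ → Cell N
    forestS zero    v = λ _ → nothing
    forestS (suc k) v = extend (forestS k v) k (P.final k v)

    colS : ℕ → Fin n → ℕ
    colS zero    v = 0
    colS (suc k) v = if P.keep k v then k else colS k v

    cluS : ℕ → Fin n → ℕ
    cluS zero    v = 0
    cluS (suc k) v = if P.keep k v then labelℕ (P.final k v) else cluS k v

    -- The invariant of the run: the state after `t` rounds of phase `k`.
    spec : ℕ → ℕ → Fin n → Node N B
    spec k t v = node (ι v) k t d (A k v) (P.cells k t v) (forestS k v) (colS k v) (cluS k v)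

    update-spread : ∀ k t v → t < 2 + B → update (spec k t v) (inbox (P.cells k t) v) ≡ spec k (suc t) v
    update-spread k t v lt rewrite Equivalence.to T-≡ (<⇒<ᵇ lt) = refl

    update-finish : ∀ k v → update (spec k (2 + B) v) (inbox (P.cells k (2 + B)) v) ≡ spec (suc k) 0 v
    update-finish k v rewrite ¬-not (λ eq → n≮n (2 + B) (<ᵇ⇒< (2 + B) (2 + B) (Equivalence.from T-≡ eq))) =
      cong (λ a → node (ι v) (suc k) 0 d a nothing (forestS (suc k) v) (colS (suc k) v) (cluS (suc k) v))
           (sym (cong-app (alives-suc (λ _ → true) d k) v))

    forest-here : ∀ {k K} v → k < K → forestS K v k ≡ P.final k v
    forest-here {k} {suc K} v (s≤s k≤K) with k ≟ K
    ... | yes refl = extend-≡ (forestS k v) k (P.final k v)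
    ... | no k≢K   = trans (extend-≢ (forestS K v) (P.final K v) k≢K) (forest-here v (≤∧≢⇒< k≤K k≢K))

    forest-inv : ∀ {k} K v {c} → forestS K v k ≡ just c → k < K × P.final k v ≡ just c
    forest-inv {k} (suc K) v eq with k ≟ K
    ... | yes refl = ≤-refl , trans (sym (extend-≡ (forestS k v) k (P.final k v))) eq
    ... | no k≢K   = Product.map₁ m≤n⇒m≤1+n
                       (forest-inv K v (trans (sym (extend-≢ (forestS K v) (P.final K v) k≢K)) eq))

    -- `κ` and `x` are the colour and cluster on record; the clause on labelled neighbours is what
    -- makes the colouring proper.
    Settled : ℕ → Fin n → ℕ → ℕ → Set
    Settled k v κ x = κ ≡ k × ∃₂ λ y q → P.final k v ≡ just (y , q) × x ≡ toℕ y ×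
      (∀ {p z} → (p , just z) ∈ inbox (P.final k) v → z ≡ y)

    -- All vertices start alive, and one leaves only in a phase that keeps it. A phase that does not
    -- keep it leaves its record as it was.
    dead⇒settled : ∀ K v → A K v ≡ false → ∃ λ k → k < K × Settled k v (colS K v) (cluS K v)
    dead⇒settled zero    v ()
    dead⇒settled (suc K) v dead with P.keep K v in kept
    ... | true  = let (y , q , eq , same) = settled-elim (P.final K v) (inbox (P.final K) v) kept in
                  K , ≤-refl , refl , y , q , eq , cong labelℕ eq , same
    ... | false = let (k , k<K , s) = dead⇒settled K v (still (A K v) (trans (cong (λ b → A K v ∧ not b) (sym kept))
                                       (trans (sym (cong-app (alives-suc (λ _ → true) d K) v)) dead))) in
                  k , m≤n⇒m≤1+n k<K , s
      where
      still : ∀ b → b ∧ true ≡ false → b ≡ false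
      still false _ = refl

    module Decomposition (ι-injective : ∀ {u v} → ι u ≡ ι v → u ≡ v) (K : ℕ) (o : Fin n → Output)
      (color-o : ∀ v → color (o v) ≡ colS K v) (cluster-o : ∀ v → cluster (o v) ≡ cluS K v)
      (tree-o : ∀ v k → tree (o v) k ≡ Maybe.map (Product.map₁ toℕ) (forestS K v k)) where

      tree-intro : ∀ {k v x p} → k < K → P.final k v ≡ just (x , p) → tree (o v) k ≡ just (toℕ x , p)
      tree-intro {k} {v} k<K eq = trans (tree-o v k) (cong (Maybe.map (Product.map₁ toℕ)) (trans (forest-here v k<K) eq))

      tree-inv : ∀ k v {x p} → tree (o v) k ≡ just (x , p) →
        k < K × ∃ λ y → x ≡ toℕ y × P.final k v ≡ just (y , p)
      tree-inv k v eq with forestS K v k in feq | trans (sym (tree-o v k)) eq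
      ... | just (y , p) | refl = let (k<K , fin) = forest-inv K v feq in k<K , y , refl , fin

      parent-edge : ∀ {k x u w} → k < K → P.Parent k (2 + B) x u w → ParentOf G ident o k (toℕ x) u w
      parent-edge k<K (eq , uw , q , eqw) = tree-intro k<K eq , uw , q , tree-intro k<K eqw

      rooted : ∀ k v {x p} → tree (o v) k ≡ just (x , p) →
        ∃₂ λ w ℓ → ℓ ≤ 2 + B × Walk (TreeEdge G ident o k x) v w ℓ × IsRoot G ident o k x w
      rooted k v eq with tree-inv k v eq
      ... | k<K , y , refl , fin = let (w , ℓ , ℓ≤ , walk , root) = P.cells-path k ≤-refl v fin in
            w , ℓ , ℓ≤ , walk-map (inj₁ ∘ parent-edge k<K) walk , tree-intro k<K root

      -- A root carries its own name as label, and names are injective.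
      unique : ∀ k x u w → IsRoot G ident o k x u → IsRoot G ident o k x w → u ≡ w
      unique k x u w ru rw with tree-inv k u ru | tree-inv k w rw
      ... | _ , y , x≡y , fu | _ , z , x≡z , fw = ι-injective (trans (sym (P.cells-root k (2 + B) u fu))
            (trans (Fin.toℕ-injective (trans (sym x≡y) x≡z)) (P.cells-root k (2 + B) w fw)))

      decomposition : ∀ {c d} → (∀ v → A K v ≡ false) → K ≤ c → (2 + B) + (2 + B) ≤ d → IsDecomposition G ident o c d
      decomposition {c} {d} dead K≤c 2B≤d = record
        { color-range = λ v → let (k , k<K , col≡ , _) = dead⇒settled K v (dead v) in
            subst (_< c) (sym (trans (color-o v) col≡)) (≤-trans k<K K≤c)
        ; proper = proper′
        ; covers = λ v → let (k , k<K , col≡ , y , q , fin , clu≡ , _) = dead⇒settled K v (dead v) in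
            q , subst₂ (λ κ x → tree (o v) κ ≡ just (x , q)) (sym (trans (color-o v) col≡)) (sym (trans (cluster-o v) clu≡))
                  (tree-intro k<K fin)
        ; parent-ok = parent-ok′
        ; root-exists = λ k x v (p , eq) → let (w , _ , _ , _ , root) = rooted k v eq in w , root
        ; root-unique = unique
        ; diameter = diameter′
        }
        where
        proper′ : ∀ u v → Adj G u v → color (o u) ≡ color (o v) → cluster (o u) ≡ cluster (o v)
        proper′ u v uv col≡ with dead⇒settled K u (dead u) | dead⇒settled K v (dead v)
        ... | k , _ , ck , y , _ , _ , xy , same | j , _ , cj , z , _ , fin , xz , _
          with trans (sym (trans (color-o u) ck)) (trans col≡ (trans (color-o v) cj))
        -- Both ends were clustered in phase `k`, so the label of `v` is among those with which `u`
        -- agrees.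
        ... | refl = trans (cluster-o u) (trans xy (trans (cong toℕ (sym (same (inbox-intro (P.final k) uv fin))))
                       (sym (trans (cluster-o v) xz))))
        parent-ok′ : ∀ k x v p → tree (o v) k ≡ just (x , just p) → ∃ λ w → ParentOf G ident o k x v w
        parent-ok′ k x v p eq with tree-inv k v eq
        ... | k<K , y , refl , fin = let (w , _ , edge) = P.cells-parent k (2 + B) v fin in w , parent-edge k<K edge
        diameter′ : ∀ k x u w → InTree G ident o k x u → InTree G ident o k x w →
          ∃ λ ℓ → ℓ ≤ d × Walk (TreeEdge G ident o k x) u w ℓ
        diameter′ k x u w (_ , equ) (_ , eqw) with rooted k u equ | rooted k w eqw
        ... | r , ℓ , ℓ≤ , walk , root | r′ , ℓ′ , ℓ′≤ , walk′ , root′ with unique k x r r′ root root′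
        -- The two vertices are joined through their common root, at most `2 + B` steps from each.
        ... | refl = ℓ + ℓ′ , ≤-trans (+-mono-≤ ℓ≤ ℓ′≤) 2B≤d , walk-++ walk (walk-reverse swap walk′)

-- The algorithm realises the description

module Simulation (e B m phases : ℕ → ℕ) (F : ∀ n → Vec Bool (m n) → Vec (Fin (suc (B n))) (2 ^ e n))
  {n : ℕ} (G : Graph n) (ident : Fin n → ℕ) (r : Vec Bool (phases n * m n)) where

  open Protocol e B m phases F

  ι : Fin n → Fin (2 ^ e n)
  ι v = toFin (e n) (ident v)

  open Flood G ident ι
  open Phases {B = B n} G ident ι
  open Spec (tables (F n) (phases n) r)

  -- By `decode-encode` the messages received are exactly the labels of the neighbours, so a round
  -- is one `update` on inboxes.
  run-step : ∀ τ (ρ : Fin n → Node (2 ^ e n) (B n)) → (∀ v → run algorithm G ident r τ v ≡ ρ v) → ∀ v →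
    run algorithm G ident r (suc τ) v ≡ update (ρ v) (inbox (cell ∘ ρ) v)
  run-step τ ρ h v = cong₂ update (h v) (trans
    (sym (map-∘ (nbrs G v)))
    (map-cong (λ u → cong (ident u ,_) (trans (decode-encode (e n) _) (cong (label ∘ cell) (h u)))) (nbrs G v)))

  run-phase : ∀ k → (∀ v → run algorithm G ident r (k * (3 + B n)) v ≡ spec k 0 v) →
    ∀ t → t ≤ 2 + B n → ∀ v → run algorithm G ident r (t + k * (3 + B n)) v ≡ spec k t v
  run-phase k h zero    t≤ v = h v
  run-phase k h (suc t) t≤ v = trans
    (run-step (t + k * (3 + B n)) (spec k t) (run-phase k h t (<⇒≤ t≤)) v)
    (update-spread k t v t≤)

  run-phases : ∀ k v → run algorithm G ident r (k * (3 + B n)) v ≡ spec k 0 v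
  run-phases zero    v = refl
  run-phases (suc k) v = trans
    (run-step (2 + B n + k * (3 + B n)) (spec k (2 + B n)) (run-phase k (run-phases k) (2 + B n) ≤-refl) v)
    (update-finish k v)

  correct : (∀ {u v} → ι u ≡ ι v → u ≡ v) → ∀ {c d} → (∀ v → A (phases n) v ≡ false) →
    phases n ≤ c → (2 + B n) + (2 + B n) ≤ d → IsDecomposition G ident (outputs algorithm G ident r) c d
  correct inj = Decomposition.decomposition inj (phases n) (outputs algorithm G ident r)
    (λ v → cong col (run-phases (phases n) v))
    (λ v → cong clu (run-phases (phases n) v))
    (λ v k → cong (λ s → Maybe.map (Product.map₁ toℕ) (forest s k)) (run-phases (phases n) v))

-- Success probability

-- Otherwise monotonicity of the logarithm would make `L n` at most `⌊log₂ n ⌋`, its predecessor.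
n≤2^L : ∀ n → n ≤ 2 ^ L n
n≤2^L n with n ≤? 2 ^ L n
... | yes le = le
... | no ≰   = contradiction
  (≤-trans (≤-reflexive (sym (⌊log₂[2^n]⌋≡n (L n)))) (⌊log₂⌋-mono-≤ (<⇒≤ (≰⇒> ≰))))
  (<⇒≱ (≤-reflexive (+-comm 1 ⌊log₂ n ⌋)))

1≤L : ∀ n → 1 ≤ L n
1≤L n = m≤n+m 1 ⌊log₂ n ⌋

module Survival {n N B m : ℕ} (G : Graph n) (ident : Fin n → ℕ) (ι : Fin n → Fin N)
  (F : Vec Bool m → Vec (Fin (suc B)) N)
  (half : ∀ (D : Vec (Fin (4 + B)) N) → 2 * ∑ᵇ m (λ i → 𝟙 (gapless D (F i))) ≤ 2 ^ m) where

  open Flood G ident ι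
  open Phases {B = B} G ident ι

  -- The remaining region depends on earlier seeds, but `half` holds for every distance vector, so
  -- each fresh seed at least halves the chance of surviving, whatever the region. Hence the
  -- induction is over all `S`.
  survival : ∀ j S v → 2 ^ j * ∑ᵇ (j * m) (λ r → 𝟙 (alives S (tables F j r) j v)) ≤ 2 ^ (j * m)
  survival zero    S v = ≤-trans (≤-reflexive (*-identityˡ (𝟙 (S v)))) (𝟙≤1 (S v))
  survival (suc j) S v = begin
    2 * 2 ^ j * ∑ᵇ (m + j * m) (λ r → P (take m r) (drop m r))
      ≡⟨ cong (2 * 2 ^ j *_) (∑ᵇ-split m (j * m) P) ⟩
    2 * 2 ^ j * ∑ᵇ m inner
      ≡⟨ solve 2 (λ t x → con 2 :* t :* x := con 2 :* (x :* t)) refl (2 ^ j) (∑ᵇ m inner) ⟩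
    2 * (∑ᵇ m inner * 2 ^ j)
      ≡⟨ cong (2 *_) (∑ᵇ-*ʳ m inner (2 ^ j)) ⟨
    2 * ∑ᵇ m (λ a → inner a * 2 ^ j)
      ≤⟨ *-monoʳ-≤ 2 (∑ᵇ-mono m one) ⟩
    2 * ∑ᵇ m (λ a → 𝟙 (gapless D (F a)) * 2 ^ (j * m))
      ≡⟨ cong (2 *_) (∑ᵇ-*ʳ m (λ a → 𝟙 (gapless D (F a))) (2 ^ (j * m))) ⟩
    2 * (∑ᵇ m (λ a → 𝟙 (gapless D (F a))) * 2 ^ (j * m))
      ≡⟨ *-assoc 2 (∑ᵇ m (λ a → 𝟙 (gapless D (F a)))) (2 ^ (j * m)) ⟨
    2 * ∑ᵇ m (λ a → 𝟙 (gapless D (F a))) * 2 ^ (j * m)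
      ≤⟨ *-monoˡ-≤ (2 ^ (j * m)) (half D) ⟩
    2 ^ m * 2 ^ (j * m)
      ≡⟨ ^-distribˡ-+-* 2 m (j * m) ⟨
    2 ^ (m + j * m) ∎
    where
    open ≤-Reasoning
    open +-*-Solver
    D : Vec (Fin (4 + B)) N
    D = Region.dist S B v
    P : Vec Bool m → Vec Bool (j * m) → ℕ
    P a b = 𝟙 (alives (Phase.next S (F a)) (tables F j b) j v)
    inner : Vec Bool m → ℕ
    inner a = ∑ᵇ (j * m) (P a)
    -- A vertex removed by the first phase stays removed and contributes nothing; a survivor is
    -- handled by induction in the new region.
    survives : ∀ a b → Phase.next S (F a) v ≡ b → inner a * 2 ^ j ≤ 𝟙 b * 2 ^ (j * m)
    survives a true  _  = ≤-trans (≤-reflexive (*-comm (inner a) (2 ^ j)))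
      (≤-trans (survival j (Phase.next S (F a)) v) (≤-reflexive (sym (*-identityˡ (2 ^ (j * m))))))
    survives a false eq = ≤-trans (*-monoˡ-≤ (2 ^ j) (∑ᵇ-mono (j * m) (λ b → ≤-reflexive
        (cong 𝟙 (alives-dead (Phase.next S (F a)) (tables F j b) j v eq)))))
      (≤-reflexive (cong (_* 2 ^ j) (trans (∑ᵇ-const (j * m) 0) (*-zeroʳ (2 ^ (j * m))))))
    one : ∀ a → inner a * 2 ^ j ≤ 𝟙 (gapless D (F a)) * 2 ^ (j * m)
    one a = ≤-trans (survives a _ refl) (*-monoˡ-≤ (2 ^ (j * m)) (Phase.next⇒gapless S (F a) v))

-- The number of survivors, summed over all strings, bounds the number of bad strings, and `2 ^ k`
-- times it is at most `n * 2 ^ R`. The bound on `n * n ^ c` then brings `n ^ c` times it below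
-- `2 ^ R`.
union-bound : ∀ c {n R k} (P : Vec Bool R → Set) (alive : Vec Bool R → Fin n → Bool) →
  (∀ v → 2 ^ k * ∑ᵇ R (λ r → 𝟙 (alive r v)) ≤ 2 ^ R) → n * n ^ c ≤ 2 ^ k →
  (∀ r → (∀ v → alive r v ≡ false) → P r) → HighProb c n R P
union-bound c {n} {R} {k} P alive few n^≤ dead⇒P =
  select R good , select-unique R good ,
  All.map (λ {r} eq → dead⇒P r (λ v → 𝟙≡0 (n≤0⇒n≡0 (≤-trans (term≤sum (𝟙 ∘ alive r) v)
                                (≤-reflexive (≡ᵇ⇒≡ (count r) 0 (Equivalence.from T-≡ eq))))))) (select-all R good) ,
  (begin
    (n ^ c ∸ 1) * 2 ^ R                      ≡⟨ *-distribʳ-∸ (2 ^ R) (n ^ c) 1 ⟩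
    n ^ c * 2 ^ R ∸ 1 * 2 ^ R                ≤⟨ ∸-monoˡ-≤ (1 * 2 ^ R) (*-monoʳ-≤ (n ^ c) everything) ⟩
    n ^ c * (goods + bads) ∸ 1 * 2 ^ R       ≡⟨ cong₂ _∸_ (trans (*-distribˡ-+ (n ^ c) goods bads) (+-comm (n ^ c * goods) (n ^ c * bads))) (*-identityˡ (2 ^ R)) ⟩
    n ^ c * bads + n ^ c * goods ∸ 2 ^ R     ≤⟨ ∸-monoˡ-≤ (2 ^ R) (+-monoˡ-≤ (n ^ c * goods) rare) ⟩
    2 ^ R + n ^ c * goods ∸ 2 ^ R            ≡⟨ m+n∸m≡n (2 ^ R) (n ^ c * goods) ⟩
    n ^ c * goods                            ≡⟨ cong (n ^ c *_) (select-length R good) ⟨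
    n ^ c * _                                ∎)
  where
  open ≤-Reasoning
  open +-*-Solver
  count : Vec Bool R → ℕ
  count r = sum (𝟙 ∘ alive r)
  good : Vec Bool R → Bool
  good r = count r ≡ᵇ 0
  goods bads : ℕ
  goods = ∑ᵇ R (𝟙 ∘ good)
  bads = ∑ᵇ R count
  𝟙≡0 : ∀ {b} → 𝟙 b ≡ 0 → b ≡ false
  𝟙≡0 {false} _ = refl
  -- Each string is good or has at least one survivor.
  either : ∀ x → 1 ≤ 𝟙 (x ≡ᵇ 0) + x
  either zero    = s≤s z≤n
  either (suc x) = s≤s z≤n
  everything : 2 ^ R ≤ goods + bads
  everything = begin
    2 ^ R                                   ≡⟨ *-identityʳ (2 ^ R) ⟨
    2 ^ R * 1                               ≡⟨ ∑ᵇ-const R 1 ⟨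
    ∑ᵇ R (λ _ → 1)                          ≤⟨ ∑ᵇ-mono R (λ r → either (count r)) ⟩
    ∑ᵇ R (λ r → 𝟙 (good r) + count r)       ≡⟨ ∑ᵇ-+ R (𝟙 ∘ good) count ⟩
    goods + bads                            ∎
  bads≤ : 2 ^ k * bads ≤ n * 2 ^ R
  bads≤ = begin
    2 ^ k * bads                                                 ≡⟨ cong (2 ^ k *_) (∑ᵇ-sum R (λ v r → 𝟙 (alive r v))) ⟩
    2 ^ k * sum (λ v → ∑ᵇ R (λ r → 𝟙 (alive r v)))               ≡⟨ *-distribˡ-sum (2 ^ k) (λ v → ∑ᵇ R (λ r → 𝟙 (alive r v))) ⟩
    sum (λ v → 2 ^ k * ∑ᵇ R (λ r → 𝟙 (alive r v)))               ≤⟨ sum-mono few ⟩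
    sum {n} (λ _ → 2 ^ R)                                        ≡⟨ sum-const n (2 ^ R) ⟩
    n * 2 ^ R                                                    ∎
  rare : n ^ c * bads ≤ 2 ^ R
  rare = *-cancelˡ-≤ (2 ^ k) {{m^n≢0 2 k}} (begin
    2 ^ k * (n ^ c * bads)         ≡⟨ solve 3 (λ t y b → t :* (y :* b) := y :* (t :* b)) refl (2 ^ k) (n ^ c) bads ⟩
    n ^ c * (2 ^ k * bads)         ≤⟨ *-monoʳ-≤ (n ^ c) bads≤ ⟩
    n ^ c * (n * 2 ^ R)            ≡⟨ solve 3 (λ x y r → y :* (x :* r) := x :* y :* r) refl n (n ^ c) (2 ^ R) ⟩
    n * n ^ c * 2 ^ R              ≤⟨ *-monoˡ-≤ (2 ^ R) n^≤ ⟩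
    2 ^ k * 2 ^ R                  ∎)

-- Parameters and bounds

module Main (s : ℕ) (family : ∀ e → HalfGapped s e) (a c : ℕ) where

  e B m phases : ℕ → ℕ
  e n      = a * L n
  B n      = maxDelay s (e n)
  m n      = seedLength s (e n)
  -- This many halvings reach `n ^ (c + 1)`; one factor `n` is spent on the union over vertices.
  phases n = suc c * L n

  F : ∀ n → Vec Bool (m n) → Vec (Fin (suc (B n))) (2 ^ e n)
  F n = proj₁ (family (e n))

  open Protocol e B m phases F

  -- `Q` is the linear constant in the seed length. `K` is at least 2, the exponent for a product of
  -- two logarithmic quantities, at least `suc c * Q` for rounds and random bits, and at least
  -- `2 * Q` for the diameter.
  Q K : ℕ
  Q = 6 + s * 7 + (s * a + a)
  K = 2 + 2 * (suc c * Q)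

  m≤ : ∀ n → m n ≤ Q * L n
  m≤ n = begin
    6 + s * (7 + a * ℓ) + a * ℓ              ≡⟨ solve 3 (λ s a l → con 6 :+ s :* (con 7 :+ a :* l) :+ a :* l := (con 6 :+ s :* con 7) :+ (s :* a :+ a) :* l) refl s a ℓ ⟩
    6 + s * 7 + (s * a + a) * ℓ              ≤⟨ +-monoˡ-≤ ((s * a + a) * ℓ) (≤-trans (≤-reflexive (sym (*-identityʳ (6 + s * 7)))) (*-monoʳ-≤ (6 + s * 7) (1≤L n))) ⟩
    (6 + s * 7) * ℓ + (s * a + a) * ℓ        ≡⟨ *-distribʳ-+ ℓ (6 + s * 7) (s * a + a) ⟨
    Q * ℓ                                    ∎
    where
    open ≤-Reasoning
    open +-*-Solver
    ℓ : ℕ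
    ℓ = L n

  3+B≤m : ∀ n → 3 + B n ≤ m n
  3+B≤m n = ≤-trans (n≤1+n (3 + B n)) (m≤m+n (4 + B n) (e n))

  2Q≤K : 2 * Q ≤ K
  2Q≤K = m≤n⇒m≤o+n 2 (*-monoʳ-≤ 2 (m≤m+n Q (c * Q)))

  polylog : ∀ n {x} → x ≤ m n → phases n * x ≤ K * L n ^ K
  polylog n {x} x≤m = begin
    suc c * ℓ * x               ≤⟨ *-monoʳ-≤ (suc c * ℓ) (≤-trans x≤m (m≤ n)) ⟩
    suc c * ℓ * (Q * ℓ)         ≡⟨ solve 3 (λ c q l → c :* l :* (q :* l) := c :* q :* (l :* (l :* con 1))) refl (suc c) Q ℓ ⟩
    suc c * Q * ℓ ^ 2           ≤⟨ *-mono-≤ (m≤n⇒m≤o+n 2 (m≤n*m (suc c * Q) 2)) (^-monoʳ-≤ ℓ {{>-nonZero (1≤L n)}} (m≤m+n 2 (2 * (suc c * Q)))) ⟩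
    K * ℓ ^ K                   ∎
    where
    open ≤-Reasoning
    open +-*-Solver
    ℓ : ℕ
    ℓ = L n

  bounds : Bounds K algorithm
  bounds = (λ n → polylog n (3+B≤m n)) , (λ n → polylog n ≤-refl) , (λ n s i →
    ≤-trans (length-encode (e n) (label (Node.cell s))) (≤-trans (+-monoˡ-≤ (e n) (s≤s z≤n))
      (≤-trans (m≤ n) (*-monoˡ-≤ (L n) (≤-trans (m≤n*m Q 2) 2Q≤K)))))

  phases≤ : ∀ n → phases n ≤ K * L n
  phases≤ n = *-monoˡ-≤ (L n) (m≤n⇒m≤o+n 2 (≤-trans (m≤m*n (suc c) Q) (m≤n*m (suc c * Q) 2)))

  diameter≤ : ∀ n → (2 + B n) + (2 + B n) ≤ K * L n * L n
  diameter≤ n = begin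
    (2 + B n) + (2 + B n)      ≤⟨ +-mono-≤ half half ⟩
    Q * L n + Q * L n          ≡⟨ solve 2 (λ q l → q :* l :+ q :* l := con 2 :* q :* l) refl Q (L n) ⟩
    2 * Q * L n                ≤⟨ *-monoˡ-≤ (L n) 2Q≤K ⟩
    -- The diameter is already logarithmic; the further factor matches the form of the claim.
    K * L n                    ≤⟨ m≤m*n (K * L n) (L n) {{>-nonZero (1≤L n)}} ⟩
    K * L n * L n              ∎
    where
    open ≤-Reasoning
    open +-*-Solver
    half : 2 + B n ≤ Q * L n
    half = ≤-trans (n≤1+n (2 + B n)) (≤-trans (3+B≤m n) (m≤ n))

  succeeds : ∀ n (G : Graph n) (ident : Fin n → ℕ) → ValidIds a n ident →
    HighProb c n (randBits algorithm n)
      (λ r → IsDecomposition G ident (outputs algorithm G ident r) (K * L n) (K * L n * L n))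
  succeeds n G ident (ident-injective , ident<) = union-bound c {k = phases n} _
    (λ r → Phases.alives G ident ι (λ _ → true) (tables (F n) (phases n) r) (phases n))
    (Survival.survival G ident ι (F n) (proj₂ (family (e n))) (phases n) (λ _ → true))
    (begin
      n ^ suc c                 ≤⟨ ^-monoˡ-≤ (suc c) (n≤2^L n) ⟩
      (2 ^ L n) ^ suc c         ≡⟨ ^-*-assoc 2 (L n) (suc c) ⟩
      2 ^ (L n * suc c)         ≡⟨ cong (2 ^_) (*-comm (L n) (suc c)) ⟩
      2 ^ phases n              ∎)
    (λ r dead → Simulation.correct e B m phases F G ident r ι-injective dead (phases≤ n) (diameter≤ n))
    where
    open ≤-Reasoning
    ι : Fin n → Fin (2 ^ e n)
    ι v = toFin (e n) (ident v)
    -- Valid identifiers lie below `2 ^ e n`, so the reduction in `toFin` does not merge them.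
    ι-injective : ∀ {u v} → ι u ≡ ι v → u ≡ v
    ι-injective {u} {v} eq = ident-injective
      (trans (sym (toℕ-toFin (e n) (ident< u))) (trans (cong toℕ eq) (toℕ-toFin (e n) (ident< v))))

theorem3p6 : ∀ (a c : ℕ) → ∃ λ (K : ℕ) → ∃ λ (A : Algorithm) →
    Bounds K A ×
    (∀ n (G : Graph n) (ident : Fin n → ℕ) → ValidIds a n ident →
    HighProb c n (randBits A n)
    (λ r → IsDecomposition G ident (outputs A G ident r) (K * L n) (K * L n * L n)))
theorem3p6 a c = Main.K 127 delay-family a c , Protocol.algorithm e B m phases F ,
  Main.bounds 127 delay-family a c , Main.succeeds 127 delay-family a c
  where open Main 127 delay-family a c using (e; B; m; phases; F)
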